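{- Every bipartite graph $G$ with treewidth at most two (and at least one edge and no isolated vertices) is constructible by conditioning. In particular, if $G$ is interpreted as a two-prover question set, then it admits exponential parallel repetition.
   Context: Treewidth: a tree decomposition of a graph $G$ is a tree $T$ whose nodes (buckets) are subsets of $V(G)$ such that for each vertex $v$ the buckets containing $v$ form a nonempty connected subtree, and each edge has both endpoints in some bucket; its width is the maximum bucket size minus one, and $\mathrm{tw}(G)$ is the minimum width. A bipartite graph $(X,Y,E)$ with $E\subseteq X\times Y$ is viewed as a 2-partite hypergraph (and as a two-prover question set $E\subseteq X\times Y$, $Q^{(1)}=X$, $Q^{(2)}=Y$). A homomorphism $(X,Y,E)\to(X',Y',E')$ is a pair of maps $X\to X'$, $Y\to Y'$ mapping edges to edges. For $X_0\subseteq X,Y_0\subseteq Y$ the induced subgraph is $(X_0,Y_0,E\cap(X_0\times Y_0))$. Constructible by conditioning (recursively, up to renaming of vertices): (1) A single edge is constructible. (2) Doubling: given a constructible graph whose vertices are partitioned into "fixed" and "old" vertices, add for every old vertex $q$ a fresh copy $q'$ on the same side, and for every edge $e$ not both of whose endpoints are fixed add the edge $e'$ obtained by replacing each old endpoint by its copy; the result is constructible. (3) Collapse: if $H$ is constructible, $H_0$ is an induced subgraph of $H$, and some homomorphism $H\to H_0$ is the identity on the vertices of $H_0$, then $H_0$ is constructible. Games: a two-prover game with question set $E$ is $(E,A^{(1)}\times A^{(2)},V)$, $V:E\times A^{(1)}\times A^{(2)}\to\{0,1\}$; its value is the maximum over strategies $\mathcal{S}^{(1)}:X\to A^{(1)}$,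 $\mathcal{S}^{(2)}:Y\to A^{(2)}$ of the probability over uniform $(x,y)\in E$ that $V$ accepts $(x,y,\mathcal{S}^{(1)}(x),\mathcal{S}^{(2)}(y))$; trivial if value 1. $\mathcal{G}^n$ has question set $E^n$, answer alphabets $(A^{(j)})^n$, accepts iff all coordinates accept. $\omega_E(n)$ is the supremum of $\mathrm{val}(\mathcal{G}^n)$ over non-trivial games with question set $E$; exponential parallel repetition means $\omega_E(n)\le C^n$ for all $n$ for some $C<1$. -}

module Defs where

open import Data.Nat using (ℕ; zero; suc; _+_; _*_; _^_; _≤_; _<_)
open import Data.Fin using (Fin; zero; suc; toℕ)
open import Data.Fin.Subset using (Subset; _∈_; ∣_∣)
open import Data.Bool using (Bool; true; false; _∧_; if_then_else_)
open import Data.Vec using (Vec; []; _∷_)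
open import Data.Unit using (⊤)
open import Data.Empty using (⊥)
open import Data.Sum using (_⊎_; inj₁; inj₂)
open import Data.Product using (Σ; _×_; _,_; proj₁; ∃; ∃-syntax)
open import Relation.Nullary using (¬_)
open import Relation.Binary.PropositionalEquality using (_≡_)
open import Function using (_∘_)
open import Function.Bundles using (_↔_; _⇔_; Inverse)

-- Constructibility by conditioning.
-- A bipartite graph is given by two vertex types X, Y and an edge
-- relation R : X → Y → Set (E = {(x,y) | R x y}).  All graphs produced
-- are finite, since the base case is finite and the rules preserve
-- finiteness.

module Doubling {X Y : Set} (R : X → Y → Set)
                (fixX : X → Bool) (fixY : Y → Bool) where
  OldX : Set
  OldX = Σ X (λ x → fixX x ≡ false)
  OldY : Set
  OldY = Σ Y (λ y → fixY y ≡ false)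

  X' : Set
  X' = X ⊎ OldX
  Y' : Set
  Y' = Y ⊎ OldY

  copyX : X → X'
  copyX x with fixX x in eq
  ... | true  = inj₁ x
  ... | false = inj₂ (x , eq)

  copyY : Y → Y'
  copyY y with fixY y in eq
  ... | true  = inj₁ y
  ... | false = inj₂ (y , eq)

  data R' : X' → Y' → Set where
    orig : ∀ {x y} → R x y → R' (inj₁ x) (inj₁ y)
    copy : ∀ {x y} → R x y → ¬ (fixX x ≡ true × fixY y ≡ true) →
           R' (copyX x) (copyY y)

module Collapse {X Y : Set} (R : X → Y → Set)
                (inX : X → Bool) (inY : Y → Bool) where
  X₀ : Set
  X₀ = Σ X (λ x → inX x ≡ true)
  Y₀ : Set
  Y₀ = Σ Y (λ y → inY y ≡ true)
  R₀ : X₀ → Y₀ → Set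
  R₀ a b = R (proj₁ a) (proj₁ b)

  record Retraction : Set where
    field
      hX : X → X₀
      hY : Y → Y₀
      hom : ∀ x y → R x y → R₀ (hX x) (hY y)
      idX : ∀ a → hX (proj₁ a) ≡ a
      idY : ∀ b → hY (proj₁ b) ≡ b

data Constructible : (X Y : Set) → (X → Y → Set) → Set₁ where
  single : Constructible ⊤ ⊤ (λ _ _ → ⊤)
  double : ∀ {X Y} {R : X → Y → Set} (fixX : X → Bool) (fixY : Y → Bool) →
           Constructible X Y R →
           Constructible (Doubling.X' R fixX fixY) (Doubling.Y' R fixX fixY)
                         (Doubling.R' R fixX fixY)
  collapse : ∀ {X Y} {R : X → Y → Set} (inX : X → Bool) (inY : Y → Bool) →
             Constructible X Y R →
             Collapse.Retraction R inX inY →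
             Constructible (Collapse.X₀ R inX inY) (Collapse.Y₀ R inX inY)
                           (Collapse.R₀ R inX inY)
  rename : ∀ {X Y X' Y'} {R : X → Y → Set} {R' : X' → Y' → Set}
           (f : X ↔ X') (g : Y ↔ Y') →
           (∀ x y → R x y ⇔ R' (Inverse.to f x) (Inverse.to g y)) →
           Constructible X Y R → Constructible X' Y' R'

Edge : ∀ {m n} → (Fin m → Fin n → Bool) → Fin m → Fin n → Set
Edge E x y = E x y ≡ true

-- Trees on the node set Fin (suc t), encoded by a parent function:
-- node (suc i) is joined to its parent `par i`, which has a smaller index.
-- Every finite nonempty tree arises this way (up to relabelling nodes).

record Tree : Set where
  field
    t     : ℕ
    par   : Fin t → Fin (suc t)
    par<  : ∀ i → toℕ (par i) < toℕ (suc i)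

  Node : Set
  Node = Fin (suc t)

  Adj : Node → Node → Set
  Adj j k = (Σ (Fin t) λ a → j ≡ suc a × par a ≡ k)
          ⊎ (Σ (Fin t) λ a → k ≡ suc a × par a ≡ j)

  data ConnIn (S : Node → Set) : Node → Node → Set where
    here : ∀ {i} → S i → ConnIn S i i
    step : ∀ {i j k} → ConnIn S i j → Adj j k → S k → ConnIn S i k

-- A tree decomposition of the bipartite graph (Fin m, Fin n, E), whose
-- vertex set is Fin m ⊎ Fin n; a bucket is a pair of subsets.
record TreeDecomposition {m n : ℕ} (E : Fin m → Fin n → Bool) : Set where
  field
    tree : Tree
  open Tree tree public
  field
    bucketX : Node → Subset m
    bucketY : Node → Subset n
    nonemptyX : ∀ x → ∃[ i ] (x ∈ bucketX i)
    nonemptyY : ∀ y → ∃[ i ] (y ∈ bucketY i)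
    connectedX : ∀ x i j → x ∈ bucketX i → x ∈ bucketX j →
                 ConnIn (λ k → x ∈ bucketX k) i j
    connectedY : ∀ y i j → y ∈ bucketY i → y ∈ bucketY j →
                 ConnIn (λ k → y ∈ bucketY k) i j
    covers : ∀ x y → Edge E x y → ∃[ i ] (x ∈ bucketX i × y ∈ bucketY i)

  bucketSize : Node → ℕ
  bucketSize i = ∣ bucketX i ∣ + ∣ bucketY i ∣

TreewidthAtMost : ∀ {m n} → ℕ → (Fin m → Fin n → Bool) → Set
TreewidthAtMost w E =
  Σ (TreeDecomposition E) λ D →
    ∀ i → TreeDecomposition.bucketSize D i ≤ suc w

sumFin : ∀ n → (Fin n → ℕ) → ℕ
sumFin zero    f = 0
sumFin (suc n) f = f zero + sumFin n (f ∘ suc)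

sumVec : ∀ m k → (Vec (Fin m) k → ℕ) → ℕ
sumVec m zero    f = f []
sumVec m (suc k) f = sumFin m (λ x → sumVec m k (λ v → f (x ∷ v)))

ind : Bool → ℕ
ind b = if b then 1 else 0

-- a game with question set E: answer alphabets Fin (suc a₁), Fin (suc a₂)
-- and a verifier predicate (only its values on edges matter)
record Game {m n : ℕ} (E : Fin m → Fin n → Bool) : Set where
  field
    a₁ a₂ : ℕ
    V : Fin m → Fin n → Fin (suc a₁) → Fin (suc a₂) → Bool

  NonTrivial : Set
  NonTrivial = ∀ (S₁ : Fin m → Fin (suc a₁)) (S₂ : Fin n → Fin (suc a₂)) →
               ¬ (∀ x y → Edge E x y → V x y (S₁ x) (S₂ y) ≡ true)

  allEdges : ∀ {k} → Vec (Fin m) k → Vec (Fin n) k → Bool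
  allEdges []       []       = true
  allEdges (x ∷ xs) (y ∷ ys) = E x y ∧ allEdges xs ys

  allAccept : ∀ {k} → Vec (Fin m) k → Vec (Fin n) k →
              Vec (Fin (suc a₁)) k → Vec (Fin (suc a₂)) k → Bool
  allAccept []       []       []       []       = true
  allAccept (x ∷ xs) (y ∷ ys) (a ∷ as) (b ∷ bs) =
    V x y a b ∧ allAccept xs ys as bs

  numQuestions : ℕ → ℕ
  numQuestions k = sumVec m k (λ xs → sumVec n k (λ ys → ind (allEdges xs ys)))

  numWon : ∀ k → (Vec (Fin m) k → Vec (Fin (suc a₁)) k) →
           (Vec (Fin n) k → Vec (Fin (suc a₂)) k) → ℕ
  numWon k S₁ S₂ = sumVec m k (λ xs → sumVec n k (λ ys →
    ind (allEdges xs ys ∧ allAccept xs ys (S₁ xs) (S₂ ys))))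

-- val(𝒢^k) ≤ (p/q)^k, i.e. for all strategies
-- (won / |E^k|) ≤ (p/q)^k  ⇔  won * q^k ≤ p^k * |E^k|
ValRepAtMost : ∀ {m n} {E : Fin m → Fin n → Bool} →
               Game E → ℕ → ℕ → ℕ → Set
ValRepAtMost {m} {n} G p q k =
  ∀ (S₁ : Vec (Fin m) k → Vec (Fin (suc (Game.a₁ G))) k)
    (S₂ : Vec (Fin n) k → Vec (Fin (suc (Game.a₂ G))) k) →
  Game.numWon G k S₁ S₂ * q ^ k ≤ p ^ k * Game.numQuestions G k

-- exponential parallel repetition: there is a constant C = p/q < 1 with
-- ω_E(k) ≤ C^k for all k, i.e. val(𝒢^k) ≤ C^k for every non-trivial game
-- 𝒢 with question set E and every k.
ExponentialParallelRepetition : ∀ {m n} → (Fin m → Fin n → Bool) → Set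
ExponentialParallelRepetition E =
  Σ ℕ λ p → Σ ℕ λ q → p < q ×
    (∀ (G : Game E) → Game.NonTrivial G → ∀ k → ValRepAtMost G p q k)

-- Repetition.  For a constructible R there is a random homomorphism R → E, taking every
-- homomorphism as a value, such that k independent coordinates map R into any given
-- W ⊆ E^k of density μ with probability at least μ^K: a doubling resamples the old vertices
-- conditionally on the fixed ones (Cauchy–Schwarz, K ↦ 2K) and a collapse restricts.  For
-- R = E and W the set of winning questions no coordinate can be the identity, so
-- μ^K ≤ (1 - 1/T)^k ≤ (1 - 1/(KT))^(Kk) with T the size of the sample space.
--
-- Treewidth two.  Along the tree decomposition one builds constructible graphs H with a
-- homomorphism π to G and a partial section of π such that paths of G of bounded length between two
-- vertices of a common bag lift to paths of H of the same length.  To add c to a bag {a, b, c}, walk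
-- from a towards c: a vertex next to a is added by doubling, either fixing a alone and folding
-- the second copy onto an edge, or fixing a and b and folding it onto a shortest path from a
-- to b, according to the distances to b.  When all vertices are lifted, edges lift too, and G
-- is a retract of H.

module Submission where

open import Defs
open import Axiom.UniquenessOfIdentityProofs using (module Decidable⇒UIP)
open import Data.Bool using (Bool; true; false; not; if_then_else_; _∧_; _∨_)
import Data.Bool.Properties as Bool
open import Data.Empty using (⊥)
open import Data.Fin using (Fin; zero; suc; toℕ; fromℕ<)
import Data.Fin.Properties as Fin
open import Data.Fin.Subset using (Subset; ∣_∣) renaming (_∈_ to _∈ₛ_)
open import Data.List as List using (List; []; _∷_; _++_; length)
import Data.List.Properties as List
open import Data.List.Membership.Propositional using (_∈_)
open import Data.List.Membership.Propositional.Properties using (∈-lookup; ∈-map⁺; ∈-map⁻; ∈-++⁺ˡ; ∈-++⁺ʳ; ∈-++⁻)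
open import Data.List.Relation.Unary.All as All using (All; []; _∷_)
import Data.List.Relation.Unary.All.Properties as All
open import Data.List.Relation.Unary.Any as Any using (Any; here; there)
import Data.List.Relation.Unary.Any.Properties as Any
open import Data.Maybe as Maybe using (Maybe; just; nothing)
import Data.Maybe.Properties as Maybe
open import Data.Nat hiding (_≟_)
open import Data.Nat.Divisibility using (_∣_; m≤n⇒m!∣n!; m∣m*n; ∣-trans)
open import Data.Nat.Properties hiding (_≟_)
open import Data.Nat.Tactic.RingSolver using (solve-∀)
open import Data.Product using (Σ; _×_; _,_; proj₁; proj₂; ∃; ∃-syntax; uncurry)
import Data.Product.Properties as Product
open import Data.Sum as Sum using (_⊎_; inj₁; inj₂)
import Data.Sum.Properties as Sum
open import Data.Unit using (⊤; tt)
open import Data.Vec as Vec using (Vec; []; _∷_; here; there)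
import Data.Vec.Properties as Vec
open import Function using (_∘_; id; _$_)
open import Function.Bundles using (_↔_; _⇔_; Inverse; Equivalence; mk⇔; mk↔ₛ′)
open import Relation.Binary.Definitions using (DecidableEquality)
open import Relation.Binary.PropositionalEquality hiding ([_])
open import Relation.Nullary
open import Relation.Nullary.Decidable using (_→-dec_; _×-dec_; _⊎-dec_; map′; does-⇔; dec-true; dec-false; decidable-stable)

-- Finite sums

-- The constant has to depend on `E` alone, whatever the answer alphabets. So the sampler handles an
-- arbitrary `W`, and its size and exponent come only from the construction of the graph. All laws
-- are uniform on some `Fin T`, with integer weights realised by repetition, so that probabilities
-- become inequalities between natural numbers. In the graph part, keeping edges liftable is not an
-- inductive invariant. If c is adjacent to both a and b, its lift is copied from a walk of length
-- two between the lifts of a and b, so H must contain such a walk before c is lifted. Hence lengths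
-- of paths between bag vertices are controlled as well. The control is bounded because reaching c
-- uses up as many steps as the path to c has; with finitely many bags a large initial bound still
-- leaves length 1, the edges, at the end. Bipartiteness makes it enough to lift a shortest path,
-- since longer ones differ from it by an even number of steps. Bags of three vertices suit the
-- method: a doubling can keep the lifts of two bag vertices in place while copying a walk between
-- them, and the third vertex is found on that copy.

variable
  A : Set
  a b k : ℕ

sumFin-cong : {f g : Fin a → ℕ} → (∀ i → f i ≡ g i) → sumFin a f ≡ sumFin a g
sumFin-cong {zero}  h = refl
sumFin-cong {suc a} h = cong₂ _+_ (h zero) (sumFin-cong (h ∘ suc))

sumFin-mono : {f g : Fin a → ℕ} → (∀ i → f i ≤ g i) → sumFin a f ≤ sumFin a g
sumFin-mono {zero}  h = z≤n
sumFin-mono {suc a} h = +-mono-≤ (h zero) (sumFin-mono (h ∘ suc))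

sumFin-+ : (f g : Fin a → ℕ) → sumFin a (λ i → f i + g i) ≡ sumFin a f + sumFin a g
sumFin-+ {zero}  f g = refl
sumFin-+ {suc a} f g rewrite sumFin-+ (f ∘ suc) (g ∘ suc) = +-interchange (f zero) _ _ _
  where
  +-interchange : ∀ w x y z → (w + x) + (y + z) ≡ (w + y) + (x + z)
  +-interchange = solve-∀

sumFin-*ˡ : ∀ c (f : Fin a → ℕ) → sumFin a (λ i → c * f i) ≡ c * sumFin a f
sumFin-*ˡ {zero}  c f = sym (*-zeroʳ c)
sumFin-*ˡ {suc a} c f rewrite sumFin-*ˡ c (f ∘ suc) = sym (*-distribˡ-+ c (f zero) _)

sumFin-zero : ∀ a → sumFin a (λ _ → 0) ≡ 0
sumFin-zero zero    = refl
sumFin-zero (suc a) = sumFin-zero a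

sumFin-one : ∀ a → sumFin a (λ _ → 1) ≡ a
sumFin-one zero    = refl
sumFin-one (suc a) = cong suc (sumFin-one a)

term≤sumFin : (f : Fin a → ℕ) (i : Fin a) → f i ≤ sumFin a f
term≤sumFin f zero    = m≤m+n _ _
term≤sumFin f (suc i) = ≤-trans (term≤sumFin (f ∘ suc) i) (m≤n+m _ _)

sumVec-cong : ∀ k {f g : Vec (Fin a) k → ℕ} → (∀ v → f v ≡ g v) → sumVec a k f ≡ sumVec a k g
sumVec-cong zero    h = h []
sumVec-cong (suc k) h = sumFin-cong (λ x → sumVec-cong k (h ∘ (x ∷_)))

sumVec-mono : ∀ k {f g : Vec (Fin a) k → ℕ} → (∀ v → f v ≤ g v) → sumVec a k f ≤ sumVec a k g
sumVec-mono zero    h = h []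
sumVec-mono (suc k) h = sumFin-mono (λ x → sumVec-mono k (h ∘ (x ∷_)))

sumVec-+ : ∀ k (f g : Vec (Fin a) k → ℕ) → sumVec a k (λ v → f v + g v) ≡ sumVec a k f + sumVec a k g
sumVec-+ zero    f g = refl
sumVec-+ {a} (suc k) f g = trans (sumFin-cong (λ x → sumVec-+ k (f ∘ (x ∷_)) (g ∘ (x ∷_))))
  (sumFin-+ {a} (λ x → sumVec a k (f ∘ (x ∷_))) (λ x → sumVec a k (g ∘ (x ∷_))))

sumVec-*ˡ : ∀ k c (f : Vec (Fin a) k → ℕ) → sumVec a k (λ v → c * f v) ≡ c * sumVec a k f
sumVec-*ˡ zero    c f = refl
sumVec-*ˡ {a} (suc k) c f = trans (sumFin-cong (λ x → sumVec-*ˡ k c (f ∘ (x ∷_))))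
  (sumFin-*ˡ {a} c (λ x → sumVec a k (f ∘ (x ∷_))))

sumVec-*ʳ : ∀ k c (f : Vec (Fin a) k → ℕ) → sumVec a k (λ v → f v * c) ≡ sumVec a k f * c
sumVec-*ʳ k c f = trans (sumVec-cong k (λ v → *-comm (f v) c)) (trans (sumVec-*ˡ k c f) (*-comm c _))

sumVec-zero : ∀ a k → sumVec a k (λ _ → 0) ≡ 0
sumVec-zero a zero    = refl
sumVec-zero a (suc k) = trans (sumFin-cong {a} (λ _ → sumVec-zero a k)) (sumFin-zero a)

sumFin-sumVec-swap : ∀ l (f : Fin a → Vec (Fin b) l → ℕ) →
  sumFin a (λ x → sumVec b l (f x)) ≡ sumVec b l (λ v → sumFin a (λ x → f x v))
sumFin-sumVec-swap {zero}  {b} l f = sym (sumVec-zero b l)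
sumFin-sumVec-swap {suc a} l f =
  trans (cong (sumVec _ l (f zero) +_) (sumFin-sumVec-swap l (f ∘ suc))) (sym (sumVec-+ l _ _))

sumVec-swap : ∀ k l (f : Vec (Fin a) k → Vec (Fin b) l → ℕ) →
  sumVec a k (λ u → sumVec b l (f u)) ≡ sumVec b l (λ v → sumVec a k (λ u → f u v))
sumVec-swap zero    l f = refl
sumVec-swap {a} (suc k) l f =
  trans (sumFin-cong (λ x → sumVec-swap k l (f ∘ (x ∷_))))
        (sumFin-sumVec-swap {a} l (λ x v → sumVec a k (λ u → f (x ∷ u) v)))

-- Products over independent coordinates

prodVec : (A → ℕ) → Vec A k → ℕ
prodVec f []      = 1
prodVec f (x ∷ v) = f x * prodVec f v

prodVec₂ : {B : Set} → (A → B → ℕ) → Vec A k → Vec B k → ℕ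
prodVec₂ f []      []      = 1
prodVec₂ f (x ∷ u) (y ∷ v) = f x y * prodVec₂ f u v

sumVec-prodVec : ∀ k (f : Fin a → ℕ) → sumVec a k (prodVec f) ≡ sumFin a f ^ k
sumVec-prodVec zero    f = refl
sumVec-prodVec {a} (suc k) f = begin
  sumFin a (λ x → sumVec a k (λ v → f x * prodVec f v))
    ≡⟨ sumFin-cong (λ x → trans (sumVec-*ˡ k (f x) (prodVec f)) (*-comm (f x) _)) ⟩
  sumFin a (λ x → sumVec a k (prodVec f) * f x)
    ≡⟨ sumFin-*ˡ (sumVec a k (prodVec f)) f ⟩
  sumVec a k (prodVec f) * sumFin a f
    ≡⟨ *-comm _ (sumFin a f) ⟩
  sumFin a f * sumVec a k (prodVec f)
    ≡⟨ cong (sumFin a f *_) (sumVec-prodVec k f) ⟩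
  sumFin a f * sumFin a f ^ k ∎
  where open ≡-Reasoning

sumVec-prodVec₂ : ∀ (f : Fin a → Fin b → ℕ) (u : Vec (Fin a) k) →
  sumVec b k (prodVec₂ f u) ≡ prodVec (λ x → sumFin b (f x)) u
sumVec-prodVec₂ f [] = refl
sumVec-prodVec₂ {a} {b} {suc k} f (x ∷ u) = begin
  sumFin b (λ y → sumVec b k (λ v → f x y * prodVec₂ f u v))
    ≡⟨ sumFin-cong (λ y → trans (sumVec-*ˡ k (f x y) (prodVec₂ f u)) (*-comm (f x y) _)) ⟩
  sumFin b (λ y → sumVec b k (prodVec₂ f u) * f x y)
    ≡⟨ sumFin-*ˡ (sumVec b k (prodVec₂ f u)) (f x) ⟩
  sumVec b k (prodVec₂ f u) * sumFin b (f x)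
    ≡⟨ *-comm _ (sumFin b (f x)) ⟩
  sumFin b (f x) * sumVec b k (prodVec₂ f u)
    ≡⟨ cong (sumFin b (f x) *_) (sumVec-prodVec₂ f u) ⟩
  sumFin b (f x) * prodVec (λ x → sumFin b (f x)) u ∎
  where open ≡-Reasoning

prodVec₂-* : {B : Set} (f g : A → B → ℕ) (u : Vec A k) (v : Vec B k) →
  prodVec₂ (λ x y → f x y * g x y) u v ≡ prodVec₂ f u v * prodVec₂ g u v
prodVec₂-* f g [] [] = refl
prodVec₂-* f g (x ∷ u) (y ∷ v) rewrite prodVec₂-* f g u v = *-interchange (f x y) _ _ _
  where
  *-interchange : ∀ w x y z → (w * x) * (y * z) ≡ (w * y) * (x * z)
  *-interchange = solve-∀

prodVec₂-constʳ : {B : Set} (f : A → ℕ) (u : Vec A k) (v : Vec B k) →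
  prodVec₂ (λ x _ → f x) u v ≡ prodVec f u
prodVec₂-constʳ f [] [] = refl
prodVec₂-constʳ f (x ∷ u) (y ∷ v) = cong (f x *_) (prodVec₂-constʳ f u v)

prodVec-const : (c : ℕ) (u : Vec A k) → prodVec (λ _ → c) u ≡ c ^ k
prodVec-const c [] = refl
prodVec-const c (x ∷ u) = cong (c *_) (prodVec-const c u)

prodVec-* : (f g : A → ℕ) (u : Vec A k) → prodVec (λ x → f x * g x) u ≡ prodVec f u * prodVec g u
prodVec-* f g u = begin
  prodVec (λ x → f x * g x) u                    ≡⟨ prodVec₂-constʳ _ u u ⟨
  prodVec₂ (λ x _ → f x * g x) u u               ≡⟨ prodVec₂-* (λ x _ → f x) (λ x _ → g x) u u ⟩
  prodVec₂ (λ x _ → f x) u u * prodVec₂ (λ x _ → g x) u u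
    ≡⟨ cong₂ _*_ (prodVec₂-constʳ f u u) (prodVec₂-constʳ g u u) ⟩
  prodVec f u * prodVec g u ∎
  where open ≡-Reasoning

^-distribʳ-* : ∀ k x y → (x * y) ^ k ≡ x ^ k * y ^ k
^-distribʳ-* zero    x y = refl
^-distribʳ-* (suc k) x y rewrite ^-distribʳ-* k x y = *-interchange x y (x ^ k) (y ^ k)
  where
  *-interchange : ∀ x y z t → (x * y) * (z * t) ≡ (x * z) * (y * t)
  *-interchange = solve-∀

-- Cauchy-Schwarz and conditional resampling

2xy≤x²+y² : ∀ x y → 2 * (x * y) ≤ x * x + y * y
2xy≤x²+y² x y with ≤-total x y
... | inj₁ x≤y with m≤n⇒∃[o]m+o≡n x≤y
...   | d , refl = ≤-trans (m≤m+n (2 * (x * (x + d))) (d * d)) (≤-reflexive (square x d))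
  where
  square : ∀ x d → 2 * (x * (x + d)) + d * d ≡ x * x + (x + d) * (x + d)
  square = solve-∀
2xy≤x²+y² x y | inj₂ y≤x with m≤n⇒∃[o]m+o≡n y≤x
...   | d , refl = ≤-trans (m≤m+n (2 * ((y + d) * y)) (d * d)) (≤-reflexive (square y d))
  where
  square : ∀ y d → 2 * ((y + d) * y) + d * d ≡ (y + d) * (y + d) + y * y
  square = solve-∀

module _ (k : ℕ) where
  private
    S : (Vec (Fin a) k → ℕ) → ℕ
    S = sumVec _ k

  sumVec-product : (f g : Vec (Fin a) k → ℕ) → S (λ u → S (λ v → f u * g v)) ≡ S f * S g
  sumVec-product f g =
    trans (sumVec-cong k (λ u → sumVec-*ˡ k (f u) g)) (sumVec-*ʳ k (S g) f)

  -- Sum 2xy ≤ x² + y² over all pairs of values of ρ. Each square occurs once for every value of the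
  -- other index, which produces the factor counting the vectors.
  cauchy-schwarz : (ρ : Vec (Fin a) k → ℕ) → S ρ * S ρ ≤ S {a} (λ _ → 1) * S (λ v → ρ v * ρ v)
  cauchy-schwarz {a} ρ = *-cancelˡ-≤ 2 (begin
    2 * (S ρ * S ρ)
      ≡⟨ cong (2 *_) (sumVec-product ρ ρ) ⟨
    2 * S (λ u → S (λ v → ρ u * ρ v))
      ≡⟨ sumVec-*ˡ k 2 _ ⟨
    S (λ u → 2 * S (λ v → ρ u * ρ v))
      ≡⟨ sumVec-cong k (λ u → sumVec-*ˡ k 2 _) ⟨
    S (λ u → S (λ v → 2 * (ρ u * ρ v)))
      ≤⟨ sumVec-mono k (λ u → sumVec-mono k (λ v → 2xy≤x²+y² (ρ u) (ρ v))) ⟩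
    S (λ u → S (λ v → ρ u * ρ u + ρ v * ρ v))
      ≡⟨ sumVec-cong k (λ u → sumVec-+ k _ _) ⟩
    S (λ u → S (λ v → ρ u * ρ u) + S (λ v → ρ v * ρ v))
      ≡⟨ sumVec-+ k _ _ ⟩
    S (λ u → S (λ v → ρ u * ρ u)) + S (λ u → S (λ v → ρ v * ρ v))
      ≡⟨ cong (_+ S (λ u → S (λ v → ρ v * ρ v))) (sumVec-swap k k (λ u _ → ρ u * ρ u)) ⟩
    S (λ v → S (λ u → ρ u * ρ u)) + S (λ u → S (λ v → ρ v * ρ v))
      ≡⟨ cong (λ z → z + z) (trans (sumVec-cong {a} k (λ _ → sumVec-cong {a} k (λ v → sym (*-identityˡ (ρ v * ρ v)))))
          (sumVec-product {a} (λ _ → 1) (λ v → ρ v * ρ v))) ⟩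
    S {a} (λ _ → 1) * S (λ v → ρ v * ρ v) + S {a} (λ _ → 1) * S (λ v → ρ v * ρ v)
      ≡⟨ cong (S {a} (λ _ → 1) * S (λ v → ρ v * ρ v) +_) (+-identityʳ _) ⟨
    2 * (S {a} (λ _ → 1) * S (λ v → ρ v * ρ v)) ∎)
    where open ≤-Reasoning

  -- With e the indicator of an equivalence relation and c constant on classes and inversely
  -- proportional to their size, e u v * c u is (up to L) the law of v resampled conditionally
  -- on the class of u.  The inequality says P(f and f′) ≥ P(f)² for the pair.
  resample : (e : Vec (Fin a) k → Vec (Fin a) k → ℕ) (c f : Vec (Fin a) k → ℕ) (L : ℕ) →
    .{{_ : NonZero L}} →
    (∀ u v → e u v ≡ e v u) →
    (∀ u v → e u v ≡ 0 ⊎ ((∀ w → e u w ≡ e v w) × c u ≡ c v)) →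
    (∀ u → c u * S (e u) ≡ L) →
    L * (S f * S f) ≤ S {a} (λ _ → 1) * S (λ u → S (λ v → (e u v * c u) * (f u * f v)))
  resample {a} e c f L e-sym e-class c-size = *-cancelˡ-≤ L (begin
    L * (L * (S f * S f))
      ≡⟨ squares L (S f) ⟩
    (L * S f) * (L * S f)
      ≡⟨ cong₂ _*_ total total ⟩
    S ρ * S ρ
      ≤⟨ cauchy-schwarz ρ ⟩
    S {a} (λ _ → 1) * S (λ v → ρ v * ρ v)
      ≡⟨ cong (S {a} (λ _ → 1) *_) energy ⟨
    S {a} (λ _ → 1) * (L * S (λ u → S (λ v → (e u v * c u) * (f u * f v))))
      ≡⟨ shuffle (S {a} (λ _ → 1)) L _ ⟩
    L * (S {a} (λ _ → 1) * S (λ u → S (λ v → (e u v * c u) * (f u * f v)))) ∎)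
    where
    open ≤-Reasoning
    squares : ∀ l s → l * (l * (s * s)) ≡ (l * s) * (l * s)
    squares = solve-∀
    shuffle : ∀ t l s → t * (l * s) ≡ l * (t * s)
    shuffle = solve-∀
    -- By `c-size`, `ρ u` is L times the average of f over the class of u. Thus `total` is the law
    -- of total expectation, and `energy` says that resampling twice gives the second moment of the
    -- conditional expectation.
    α ρ : Vec (Fin a) k → ℕ
    α u = S (λ v → e u v * f v)
    ρ u = c u * α u
    e-c : ∀ u v → e u v * c u ≡ e u v * c v
    e-c u v with e-class u v
    ... | inj₁ e≡0 rewrite e≡0 = refl
    ... | inj₂ (_ , c≡) = cong (e u v *_) c≡
    e-ρ : ∀ u v → e u v * ρ u ≡ e u v * ρ v
    e-ρ u v with e-class u v
    ... | inj₁ e≡0 rewrite e≡0 = refl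
    ... | inj₂ (e≡ , c≡) =
      cong (e u v *_) (cong₂ _*_ c≡ (sumVec-cong k (λ w → cong (_* f w) (e≡ w))))
    expand : ∀ (g : Vec (Fin a) k → ℕ) → L * S g ≡ S (λ u → S (λ v → (g u * c u) * e u v))
    expand g = trans (sym (sumVec-*ˡ k L g)) (sumVec-cong k λ u →
        trans (trans (cong (_* g u) (sym (c-size u))) (rot (c u) (S (e u)) (g u)))
              (sym (sumVec-*ˡ k (g u * c u) (e u))))
        where
        rot : ∀ x y z → (x * y) * z ≡ (z * x) * y
        rot = solve-∀
    total : L * S f ≡ S ρ
    total = trans (expand f) (trans (sumVec-swap k k _) (sumVec-cong k λ v →
      trans (sumVec-cong k (λ u → step u v)) (sumVec-*ˡ k (c v) _)))
      where
      re₁ : ∀ x y z → (x * y) * z ≡ x * (z * y)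
      re₁ = solve-∀
      re₂ : ∀ x y z → x * (z * y) ≡ y * (z * x)
      re₂ = solve-∀
      step : ∀ u v → (f u * c u) * e u v ≡ c v * (e v u * f u)
      step u v = trans (re₁ (f u) (c u) (e u v)) (trans (cong (f u *_) (e-c u v))
        (trans (re₂ (f u) (c v) (e u v)) (cong (λ z → c v * (z * f u)) (e-sym u v))))
    energy : L * S (λ u → S (λ v → (e u v * c u) * (f u * f v))) ≡ S (λ v → ρ v * ρ v)
    energy = trans (cong (L *_) (sumVec-cong k inner)) (trans (expand (λ u → f u * ρ u))
      (trans (sumVec-swap k k _) (sumVec-cong k λ v →
        trans (sumVec-cong k (λ u → step u v)) (trans (sumVec-*ˡ k (ρ v * c v) _) (re₃ (c v) (α v))))))
      where
      re₀ : ∀ e c x y → (e * c) * (x * y) ≡ (x * c) * (e * y)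
      re₀ = solve-∀
      inner : ∀ u → S (λ v → (e u v * c u) * (f u * f v)) ≡ f u * ρ u
      inner u = trans (sumVec-cong k (λ v → re₀ (e u v) (c u) (f u) (f v)))
        (trans (sumVec-*ˡ k (f u * c u) _) (*-assoc (f u) (c u) (α u)))
      re₁ : ∀ x r c e → ((x * r) * c) * e ≡ (x * c) * (e * r)
      re₁ = solve-∀
      re₂ : ∀ x c e r → (x * c) * (e * r) ≡ (x * r) * (e * c)
      re₂ = solve-∀
      re₄ : ∀ x r e c → (x * r) * (e * c) ≡ (r * c) * (e * x)
      re₄ = solve-∀
      re₃ : ∀ c x → ((c * x) * c) * x ≡ (c * x) * (c * x)
      re₃ = solve-∀
      step : ∀ u v → ((f u * ρ u) * c u) * e u v ≡ (ρ v * c v) * (e v u * f u)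
      step u v = trans (re₁ (f u) (ρ u) (c u) (e u v)) (trans (cong ((f u * c u) *_) (e-ρ u v))
        (trans (re₂ (f u) (c u) (e u v) (ρ v)) (trans (cong ((f u * ρ v) *_) (e-c u v))
        (trans (re₄ (f u) (ρ v) (e u v) (c v)) (cong (λ z → (ρ v * c v) * (z * f u)) (e-sym u v))))))

-- Sums over lists

flat : ∀ a → (Fin a → List A) → List A
flat zero    g = []
flat (suc a) g = g zero ++ flat a (g ∘ suc)

sumList : List A → (A → ℕ) → ℕ
sumList []       f = 0
sumList (x ∷ xs) f = f x + sumList xs f

sumList-++ : ∀ (xs ys : List A) f → sumList (xs ++ ys) f ≡ sumList xs f + sumList ys f
sumList-++ []       ys f = refl
sumList-++ (x ∷ xs) ys f = trans (cong (f x +_) (sumList-++ xs ys f)) (sym (+-assoc (f x) _ _))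

sumList-flat : ∀ a (g : Fin a → List A) f → sumList (flat a g) f ≡ sumFin a (λ i → sumList (g i) f)
sumList-flat zero    g f = refl
sumList-flat (suc a) g f =
  trans (sumList-++ (g zero) _ f) (cong (sumList (g zero) f +_) (sumList-flat a (g ∘ suc) f))

sumList-replicate : ∀ c (x : A) f → sumList (List.replicate c x) f ≡ c * f x
sumList-replicate zero    x f = refl
sumList-replicate (suc c) x f = cong (f x +_) (sumList-replicate c x f)

sumFin-lookup : ∀ (xs : List A) f → sumFin (length xs) (f ∘ List.lookup xs) ≡ sumList xs f
sumFin-lookup []       f = refl
sumFin-lookup (x ∷ xs) f = cong (f x +_) (sumFin-lookup xs f)

-- The doubled graph

bool-irrelevant : {p q : Bool} (h h' : p ≡ q) → h ≡ h'
bool-irrelevant = Decidable⇒UIP.≡-irrelevant Bool._≟_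

data Value {X : Set} (f : X → Bool) (x : X) (b : Bool) : Set where
  value : f x ≡ b → Value f x b

equation : ∀ {X : Set} {f : X → Bool} {x b} → Value f x b → f x ≡ b
equation (value h) = h

module DoublingProperties {X Y : Set} (R : X → Y → Set) (fixX : X → Bool) (fixY : Y → Bool) where
  open Doubling R fixX fixY

  data CopyX (x : X) : X' → Set where
    fixed : fixX x ≡ true → CopyX x (inj₁ x)
    old   : (h : fixX x ≡ false) → CopyX x (inj₂ (x , h))

  -- copyX is defined by a with-clause applied to (fixX x) and refl, and abstracting fixX x is
  -- ill-typed as long as refl is there.  So refl is first replaced by the equal but neutral
  -- term (equation v), the type of v being abstracted together with fixX x.
  copyX-view′ : ∀ x → Value fixX x (fixX x) → CopyX x (copyX x)
  copyX-view′ x v with refl {x = fixX x} | bool-irrelevant (equation v) refl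
  ... | _ | refl with fixX x
  ... | true = fixed (equation v)
  ... | false = old _

  copyX-view : ∀ x → CopyX x (copyX x)
  copyX-view x = copyX-view′ x (value refl)

  data CopyY (y : Y) : Y' → Set where
    fixed : fixY y ≡ true → CopyY y (inj₁ y)
    old   : (h : fixY y ≡ false) → CopyY y (inj₂ (y , h))

  copyY-view′ : ∀ y → Value fixY y (fixY y) → CopyY y (copyY y)
  copyY-view′ y v with refl {x = fixY y} | bool-irrelevant (equation v) refl
  ... | _ | refl with fixY y
  ... | true  = fixed (equation v)
  ... | false = old _

  copyY-view : ∀ y → CopyY y (copyY y)
  copyY-view y = copyY-view′ y (value refl)

  copyX-fixed : ∀ {x} → fixX x ≡ true → copyX x ≡ inj₁ x
  copyX-fixed {x} h with copyX x | copyX-view x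
  ... | _ | fixed _ = refl
  ... | _ | old h'  with () ← trans (sym h) h'

  copyX-old : ∀ {x} (h : fixX x ≡ false) → copyX x ≡ inj₂ (x , h)
  copyX-old {x} h with copyX x | copyX-view x
  ... | _ | old h'   = cong (λ z → inj₂ (x , z)) (bool-irrelevant h' h)
  ... | _ | fixed h' with () ← trans (sym h) h'

  copyY-fixed : ∀ {y} → fixY y ≡ true → copyY y ≡ inj₁ y
  copyY-fixed {y} h with copyY y | copyY-view y
  ... | _ | fixed _ = refl
  ... | _ | old h'  with () ← trans (sym h) h'

  copyY-old : ∀ {y} (h : fixY y ≡ false) → copyY y ≡ inj₂ (y , h)
  copyY-old {y} h with copyY y | copyY-view y
  ... | _ | old h'   = cong (λ z → inj₂ (y , z)) (bool-irrelevant h' h)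
  ... | _ | fixed h' with () ← trans (sym h) h'

  -- If both endpoints are fixed, the copied edge is the original one. So copying is a homomorphism
  -- on all of R, although the constructor `copy` excludes such edges.
  copy-edge : ∀ {x y} → R x y → R' (copyX x) (copyY y)
  copy-edge {x} {y} r with fixX x Bool.≟ true | fixY y Bool.≟ true
  ... | yes p | yes q = subst₂ R' (sym (copyX-fixed p)) (sym (copyY-fixed q)) (orig r)
  ... | no ¬p | _     = copy r (¬p ∘ proj₁)
  ... | _     | no ¬q = copy r (¬q ∘ proj₂)

-- Random homomorphisms

ind-∧ : ∀ p q → ind (p ∧ q) ≡ ind p * ind q
ind-∧ true  q = sym (*-identityˡ _)
ind-∧ false q = refl

∧-trueˡ : ∀ {p q} → p ∧ q ≡ true → p ≡ true
∧-trueˡ {true} _ = refl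

∧-trueʳ : ∀ {p q} → p ∧ q ≡ true → q ≡ true
∧-trueʳ {true} h = h

All-flat : {P : A → Set} {g : Fin a → List A} → (∀ i → All P (g i)) → All P (flat a g)
All-flat {a = zero}  h = []
All-flat {a = suc a} h = All.++⁺ (h zero) (All-flat (h ∘ suc))

Any-flat : {P : A → Set} {g : Fin a → List A} (i : Fin a) → Any P (g i) → Any P (flat a g)
Any-flat         zero    h = Any.++⁺ˡ h
Any-flat {g = g} (suc i) h = Any.++⁺ʳ (g zero) (Any-flat i h)

-- Turns an integer weight κ into a uniform law on the indices of a list. It serves for the edges of
-- E, with indicator weights, and for the coupled pairs of samples in a doubling.
module Pairs (κ : Fin a → Fin b → ℕ) where

  pairs : List (Fin a × Fin b)
  pairs = flat a (λ x → flat b (λ y → List.replicate (κ x y) (x , y)))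

  fst : Fin (length pairs) → Fin a
  fst = proj₁ ∘ List.lookup pairs

  snd : Fin (length pairs) → Fin b
  snd = proj₂ ∘ List.lookup pairs

  multiplicity-positive : ∀ i → 0 < κ (fst i) (snd i)
  multiplicity-positive i = All.lookup all (∈-lookup i)
    where
    repeated : ∀ x y → All (λ p → 0 < κ (proj₁ p) (proj₂ p)) (List.replicate (κ x y) (x , y))
    repeated x y with κ x y in eq
    ... | zero  = []
    ... | suc c = All.replicate⁺ (suc c) (subst (0 <_) (sym eq) z<s)
    all : All (λ p → 0 < κ (proj₁ p) (proj₂ p)) pairs
    all = All-flat (λ x → All-flat (λ y → repeated x y))

  pairs-complete : ∀ x y → 0 < κ x y → ∃[ i ] fst i ≡ x × snd i ≡ y
  pairs-complete x y pos = Any.index found ,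
    sym (cong proj₁ (Any.lookup-index found)) , sym (cong proj₂ (Any.lookup-index found))
    where
    repeated : ∀ c → 0 < c → Any ((x , y) ≡_) (List.replicate c (x , y))
    repeated (suc c) _ = here refl
    found : Any ((x , y) ≡_) pairs
    found = Any-flat x (Any-flat y (repeated (κ x y) pos))

  sumFin-pairs : ∀ (f : Fin a → Fin b → ℕ) →
    sumFin (length pairs) (λ i → f (fst i) (snd i)) ≡ sumFin a (λ x → sumFin b (λ y → κ x y * f x y))
  sumFin-pairs f = trans (sumFin-lookup pairs (uncurry f)) (trans (sumList-flat a _ (uncurry f))
    (sumFin-cong λ x → trans (sumList-flat b _ (uncurry f))
      (sumFin-cong λ y → sumList-replicate (κ x y) (x , y) (uncurry f))))

  length-pairs : length pairs ≡ sumFin a (λ x → sumFin b (κ x))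
  length-pairs = trans (sym (sumFin-one (length pairs))) (trans (sumFin-pairs (λ _ _ → 1))
    (sumFin-cong λ x → sumFin-cong λ y → *-identityʳ (κ x y)))

  sumVec-pairs : ∀ k (F : Vec (Fin a) k → Vec (Fin b) k → ℕ) →
    sumVec (length pairs) k (λ v → F (Vec.map fst v) (Vec.map snd v))
      ≡ sumVec a k (λ u → sumVec b k (λ v → prodVec₂ κ u v * F u v))
  sumVec-pairs zero    F = sym (*-identityˡ _)
  sumVec-pairs (suc k) F = begin
    sumFin (length pairs) (λ i → sumVec (length pairs) k (λ v → F (fst i ∷ Vec.map fst v) (snd i ∷ Vec.map snd v)))
      ≡⟨ sumFin-cong (λ i → sumVec-pairs k (λ u v → F (fst i ∷ u) (snd i ∷ v))) ⟩
    sumFin (length pairs) (λ i → tail (fst i) (snd i))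
      ≡⟨ sumFin-pairs tail ⟩
    sumFin a (λ x → sumFin b (λ y → κ x y * tail x y))
      ≡⟨ sumFin-cong (λ x → sumFin-cong (λ y → distribute x y)) ⟩
    sumFin a (λ x → sumFin b (λ y → sumVec a k (λ u → sumVec b k (λ v → prodVec₂ κ (x ∷ u) (y ∷ v) * F (x ∷ u) (y ∷ v)))))
      ≡⟨ sumFin-cong (λ x → sumFin-sumVec-swap {b} k (λ y u → sumVec b k (λ v → prodVec₂ κ (x ∷ u) (y ∷ v) * F (x ∷ u) (y ∷ v)))) ⟩
    sumFin a (λ x → sumVec a k (λ u → sumFin b (λ y → sumVec b k (λ v → prodVec₂ κ (x ∷ u) (y ∷ v) * F (x ∷ u) (y ∷ v))))) ∎
    where
    open ≡-Reasoning
    tail : Fin a → Fin b → ℕ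
    tail x y = sumVec a k (λ u → sumVec b k (λ v → prodVec₂ κ u v * F (x ∷ u) (y ∷ v)))
    distribute : ∀ x y → κ x y * tail x y ≡
      sumVec a k (λ u → sumVec b k (λ v → prodVec₂ κ (x ∷ u) (y ∷ v) * F (x ∷ u) (y ∷ v)))
    distribute x y = trans (sym (sumVec-*ˡ k (κ x y) _)) (sumVec-cong k λ u →
      trans (sym (sumVec-*ˡ k (κ x y) _)) (sumVec-cong k λ v → sym (*-assoc (κ x y) _ _)))

-- The form of finiteness that passes easily through sums, subtypes and bijections. It is what
-- decides whether two samples agree on all fixed vertices.
Searchable : Set → Set₁
Searchable X = {P : X → Set} → (∀ x → Dec (P x)) → Dec (∀ x → P x)

module _ {m n : ℕ} (E : Fin m → Fin n → Bool) where

  module EdgePairs = Pairs (λ x y → ind (E x y))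

  edgeCount : ℕ
  edgeCount = length EdgePairs.pairs

  -- The density μ of W is `count k W` divided by `edgeCount ^ k`; the inequality in `event` is the
  -- bound by `μ ^ K` with denominators cleared.
  count : ∀ k → (Vec (Fin m) k → Vec (Fin n) k → Bool) → ℕ
  count k W = sumVec m k (λ u → sumVec n k (λ v → prodVec₂ (λ x y → ind (E x y)) u v * ind (W u v)))

  -- Fin T, with the uniform law, is a random homomorphism from R to E which takes each
  -- homomorphism as value.  If (in the k-fold product) a random edge lies in W with
  -- probability μ, then all of R is mapped into W with probability at least μ ^ K; only an
  -- event implying the latter is recorded, because R need not be decidable.
  record Sampler {X Y : Set} (R : X → Y → Set) : Set₁ where
    field
      searchX : Searchable X
      searchY : Searchable Y
      T K     : ℕ
      {{T≢0}} : NonZero T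
      {{K≢0}} : NonZero K
      sampleX : Fin T → X → Fin m
      sampleY : Fin T → Y → Fin n
      full    : (fX : X → Fin m) (fY : Y → Fin n) → (∀ x y → R x y → Edge E (fX x) (fY y)) →
                ∃[ i ] (∀ x → sampleX i x ≡ fX x) × (∀ y → sampleY i y ≡ fY y)
      event   : ∀ k (W : Vec (Fin m) k → Vec (Fin n) k → Bool) →
                Σ (Vec (Fin T) k → Bool) λ A →
                  (∀ v → A v ≡ true → ∀ x y → R x y →
                     W (Vec.map (λ i → sampleX i x) v) (Vec.map (λ i → sampleY i y) v) ≡ true)
                  × count k W ^ K * T ^ k ≤ sumVec T k (ind ∘ A) * (edgeCount ^ k) ^ K

  sampler-single : ∃[ x ] ∃[ y ] Edge E x y → Sampler {⊤} {⊤} (λ _ _ → ⊤)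
  sampler-single (x₀ , y₀ , e₀) = record
    { searchX = λ P? → map′ (λ p _ → p) (_$ tt) (P? tt)
    ; searchY = λ P? → map′ (λ p _ → p) (_$ tt) (P? tt)
    ; T = edgeCount
    ; K = 1
    ; T≢0 = inhabited (proj₁ (edge-index x₀ y₀ e₀))
    ; sampleX = λ i _ → fst i
    ; sampleY = λ i _ → snd i
    ; full = λ fX fY hom → let (i , p , q) = edge-index _ _ (hom tt tt tt) in i , (λ _ → p) , (λ _ → q)
    ; event = λ k W → (λ v → W (Vec.map fst v) (Vec.map snd v)) , (λ _ h _ _ _ → h) ,
        ≤-reflexive (cong₂ _*_ (trans (*-identityʳ _) (sym (sumVec-pairs k (λ u v → ind (W u v)))))
                               (sym (*-identityʳ (edgeCount ^ k))))
    }
    where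
    open EdgePairs
    inhabited : ∀ {t} → Fin t → NonZero t
    inhabited zero    = _
    inhabited (suc _) = _
    edge-index : ∀ x y → Edge E x y → ∃[ i ] fst i ≡ x × snd i ≡ y
    edge-index x y e = pairs-complete x y (subst (λ z → 0 < ind z) (sym e) z<s)

  search-Σ : ∀ {X : Set} {f : X → Bool} {p} → Searchable X → Searchable (Σ X (λ x → f x ≡ p))
  search-Σ {X} {f} {p} search {P} P? = map′ (λ h (x , q) → h x q) (λ h x q → h (x , q)) (search fibre)
    where
    fibre : ∀ x → Dec (∀ q → P (x , q))
    fibre x with f x Bool.≟ p
    ... | no ¬q = yes (λ q → contradiction q ¬q)
    ... | yes q = map′ (λ h q′ → subst (λ z → P (x , z)) (bool-irrelevant q q′) h) (_$ q) (P? (x , q))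

  search-⊎ : ∀ {X Y : Set} → Searchable X → Searchable Y → Searchable (X ⊎ Y)
  search-⊎ sX sY P? = map′ (λ (p , q) → Sum.[ p , q ]) (λ h → h ∘ inj₁ , h ∘ inj₂)
    (sX (P? ∘ inj₁) ×-dec sY (P? ∘ inj₂))

  search-↔ : ∀ {X Y : Set} → X ↔ Y → Searchable X → Searchable Y
  search-↔ f search {P} P? = map′
    (λ h y → subst P (Inverse.strictlyInverseˡ f y) (h (Inverse.from f y)))
    (λ h x → h (Inverse.to f x)) (search (P? ∘ Inverse.to f))

  -- A homomorphism on the retract extends to R by composition with the retraction, so restricted
  -- samples still take every value. The event can stay the same because edges of the induced
  -- subgraph are edges of R.
  sampler-collapse : ∀ {X Y} {R : X → Y → Set} (inX : X → Bool) (inY : Y → Bool) →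
    Collapse.Retraction R inX inY → Sampler R → Sampler (Collapse.R₀ R inX inY)
  sampler-collapse {R = R} inX inY r s = record
    { searchX = search-Σ searchX
    ; searchY = search-Σ searchY
    ; T = T
    ; K = K
    ; sampleX = λ i → sampleX i ∘ proj₁
    ; sampleY = λ i → sampleY i ∘ proj₁
    ; full = λ fX fY f-hom →
        let (i , p , q) = full (fX ∘ hX) (fY ∘ hY) (λ x y e → f-hom (hX x) (hY y) (hom x y e))
        in i , (λ a → trans (p (proj₁ a)) (cong fX (idX a))) , (λ b → trans (q (proj₁ b)) (cong fY (idY b)))
    ; event = λ k W → let (A , sound , bound) = event k W in
        A , (λ v h x y → sound v h (proj₁ x) (proj₁ y)) , bound
    }
    where
    open Sampler s
    open Collapse.Retraction r

  sampler-rename : ∀ {X Y X' Y'} {R : X → Y → Set} {R' : X' → Y' → Set} (f : X ↔ X') (g : Y ↔ Y') →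
    (∀ x y → R x y ⇔ R' (Inverse.to f x) (Inverse.to g y)) → Sampler R → Sampler R'
  sampler-rename {R = R} {R' = R'} f g R⇔R' s = record
    { searchX = search-↔ f searchX
    ; searchY = search-↔ g searchY
    ; T = T
    ; K = K
    ; sampleX = λ i → sampleX i ∘ F.from
    ; sampleY = λ i → sampleY i ∘ G.from
    ; full = λ fX fY hom →
        let (i , p , q) = full (fX ∘ F.to) (fY ∘ G.to) (λ x y e → hom _ _ (Equivalence.to (R⇔R' x y) e))
        in i , (λ x → trans (p _) (cong fX (F.strictlyInverseˡ x)))
             , (λ y → trans (q _) (cong fY (G.strictlyInverseˡ y)))
    ; event = λ k W → let (A , sound , bound) = event k W in
        A , (λ v h x y e → sound v h _ _ (Equivalence.from (R⇔R' _ _)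
              (subst₂ R' (sym (F.strictlyInverseˡ x)) (sym (G.strictlyInverseˡ y)) e))) , bound
    }
    where
    open Sampler s
    module F = Inverse f
    module G = Inverse g

  -- Resampling the old vertices of a doubling

  module _ {X Y : Set} {R : X → Y → Set} (fixX : X → Bool) (fixY : Y → Bool) (s : Sampler R) where
    open Sampler s
    open Doubling R fixX fixY
    open DoublingProperties R fixX fixY

    private
      Agree : Fin T → Fin T → Set
      Agree i j = (∀ x → fixX x ≡ true → sampleX i x ≡ sampleX j x)
                × (∀ y → fixY y ≡ true → sampleY i y ≡ sampleY j y)

      agree? : ∀ i j → Dec (Agree i j)
      agree? i j = searchX (λ x → (fixX x Bool.≟ true) →-dec (sampleX i x Fin.≟ sampleX j x))
             ×-dec searchY (λ y → (fixY y Bool.≟ true) →-dec (sampleY i y Fin.≟ sampleY j y))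

      agree-sym : ∀ {i j} → Agree i j → Agree j i
      agree-sym (p , q) = (λ x h → sym (p x h)) , (λ y h → sym (q y h))

      agree-trans : ∀ {i j l} → Agree i j → Agree j l → Agree i l
      agree-trans (p , q) (p' , q') = (λ x h → trans (p x h) (p' x h)) , (λ y h → trans (q y h) (q' y h))

      e : Fin T → Fin T → ℕ
      e i j = ind (does (agree? i j))

      e-sym : ∀ i j → e i j ≡ e j i
      e-sym i j = cong ind (does-⇔ (mk⇔ agree-sym agree-sym) (agree? i j) (agree? j i))

      size : Fin T → ℕ
      size i = sumFin T (e i)

      e-agree : ∀ {i j} → Agree i j → e i j ≡ 1
      e-agree {i} {j} h = cong ind (dec-true (agree? i j) h)

      size>0 : ∀ i → 0 < size i
      size>0 i = ≤-trans (≤-reflexive (sym (e-agree ((λ _ _ → refl) , (λ _ _ → refl))))) (term≤sumFin (e i) i)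

      size≤T : ∀ i → size i ≤ T
      size≤T i = ≤-trans (sumFin-mono (λ j → ind≤1 (does (agree? i j)))) (≤-reflexive (sumFin-one T))
        where
        ind≤1 : ∀ p → ind p ≤ 1
        ind≤1 true  = ≤-refl
        ind≤1 false = z≤n

      ∣! : ∀ l → 0 < l → l ∣ l !
      ∣! (suc l) _ = m∣m*n (l !)

      size∣L : ∀ i → size i ∣ T !
      size∣L i = ∣-trans (∣! (size i) (size>0 i)) (m≤n⇒m!∣n! (size≤T i))

      -- The factorial is a common multiple of all class sizes, so the weights `c` are integers.
      -- Every first sample then has the same total weight L, which keeps its law uniform.
      L : ℕ
      L = T !

      c : Fin T → ℕ
      c i = _∣_.quotient (size∣L i)

      c*size : ∀ i → c i * size i ≡ L
      c*size i = sym (_∣_.equality (size∣L i))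

      c>0 : ∀ i → 0 < c i
      c>0 i with c i | c*size i
      ... | zero  | L≡0 = contradiction (1≤n! T) (<⇒≱ (≤-reflexive (cong suc (sym L≡0))))
      ... | suc _ | _   = z<s

      e-class : ∀ i j → e i j ≡ 0 ⊎ ((∀ l → e i l ≡ e j l) × c i ≡ c j)
      e-class i j with agree? i j
      ... | no ¬ij = inj₁ (cong ind (dec-false (agree? i j) ¬ij))
      ... | yes ij = inj₂ (e≡ , *-cancelʳ-≡ (c i) (c j) (size i) {{>-nonZero (size>0 i)}}
              (trans (c*size i) (trans (sym (c*size j)) (cong (c j *_) (sym (sumFin-cong e≡))))))
        where
        e≡ : ∀ l → e i l ≡ e j l
        e≡ l = cong ind (does-⇔ (mk⇔ (agree-trans (agree-sym ij)) (agree-trans ij)) (agree? i l) (agree? j l))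

      eᵏ-sym : ∀ {k} (u v : Vec (Fin T) k) → prodVec₂ e u v ≡ prodVec₂ e v u
      eᵏ-sym []      []      = refl
      eᵏ-sym (i ∷ u) (j ∷ v) = cong₂ _*_ (e-sym i j) (eᵏ-sym u v)

      eᵏ-class : ∀ {k} (u v : Vec (Fin T) k) → prodVec₂ e u v ≡ 0 ⊎
                 ((∀ w → prodVec₂ e u w ≡ prodVec₂ e v w) × prodVec c u ≡ prodVec c v)
      eᵏ-class []      []      = inj₂ ((λ { [] → refl }) , refl)
      eᵏ-class (i ∷ u) (j ∷ v) with e-class i j | eᵏ-class u v
      ... | inj₁ e≡0 | _ = inj₁ (cong (_* prodVec₂ e u v) e≡0)
      ... | inj₂ _ | inj₁ e≡0 = inj₁ (trans (cong (e i j *_) e≡0) (*-zeroʳ (e i j)))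
      ... | inj₂ (p , q) | inj₂ (p' , q') =
        inj₂ ((λ { (l ∷ w) → cong₂ _*_ (p l) (p' w) }) , cong₂ _*_ q q')

      cᵏ-size : ∀ k (u : Vec (Fin T) k) → prodVec c u * sumVec T k (prodVec₂ e u) ≡ L ^ k
      cᵏ-size k u = trans (cong (prodVec c u *_) (sumVec-prodVec₂ e u))
        (trans (sym (prodVec-* c size u)) (trans (prodVec-cong c*size u) (prodVec-const L u)))
        where
        prodVec-cong : ∀ {k} {f g : Fin T → ℕ} → (∀ i → f i ≡ g i) → (u : Vec (Fin T) k) → prodVec f u ≡ prodVec g u
        prodVec-cong h []      = refl
        prodVec-cong h (i ∷ u) = cong₂ _*_ (h i) (prodVec-cong h u)

      open Pairs (λ i j → e i j * c i)

      T' : ℕ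
      T' = length pairs

      T'≡ : T' ≡ T * L
      T'≡ = trans length-pairs (trans (sumFin-cong λ i →
              trans (sumFin-cong (λ j → *-comm (e i j) (c i))) (trans (sumFin-*ˡ (c i) (e i)) (trans (c*size i) (sym (*-identityʳ L)))))
            (trans (sumFin-*ˡ {T} L (λ _ → 1)) (trans (cong (L *_) (sumFin-one T)) (*-comm L T))))

      agrees : ∀ p → Agree (fst p) (snd p)
      agrees p = decidable-stable (agree? (fst p) (snd p)) λ ¬h →
        contradiction (subst (λ z → 0 < ind z * c (fst p)) (dec-false (agree? (fst p) (snd p)) ¬h)
                             (multiplicity-positive p)) λ ()

      sampleX' : Fin T' → X' → Fin m
      sampleX' p = Sum.[ sampleX (fst p) , sampleX (snd p) ∘ proj₁ ]

      sampleY' : Fin T' → Y' → Fin n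
      sampleY' p = Sum.[ sampleY (fst p) , sampleY (snd p) ∘ proj₁ ]

      sampleX'-copy : ∀ p x → sampleX' p (copyX x) ≡ sampleX (snd p) x
      sampleX'-copy p x with copyX x | copyX-view x
      ... | _ | fixed h = proj₁ (agrees p) x h
      ... | _ | old _   = refl

      sampleY'-copy : ∀ p y → sampleY' p (copyY y) ≡ sampleY (snd p) y
      sampleY'-copy p y with copyY y | copyY-view y
      ... | _ | fixed h = proj₂ (agrees p) y h
      ... | _ | old _   = refl

      -- A homomorphism of the doubled graph consists of two homomorphisms of R, one on the
      -- originals and one on the copies. They agree on the fixed vertices, so the corresponding
      -- pair of samples has positive weight.
      full' : (fX : X' → Fin m) (fY : Y' → Fin n) → (∀ x y → R' x y → Edge E (fX x) (fY y)) →
              ∃[ p ] (∀ x → sampleX' p x ≡ fX x) × (∀ y → sampleY' p y ≡ fY y)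
      full' fX fY hom
        with full (fX ∘ inj₁) (fY ∘ inj₁) (λ x y r → hom _ _ (orig r))
           | full (fX ∘ copyX) (fY ∘ copyY) (λ x y r → hom _ _ (copy-edge r))
      ... | i , iX , iY | j , jX , jY = p , pX , pY
        where
        ij : Agree i j
        ij = (λ x h → trans (iX x) (trans (cong fX (sym (copyX-fixed h))) (sym (jX x))))
           , (λ y h → trans (iY y) (trans (cong fY (sym (copyY-fixed h))) (sym (jY y))))
        found : ∃[ p ] fst p ≡ i × snd p ≡ j
        found = pairs-complete i j
          (subst (0 <_) (sym (trans (cong (_* c i) (e-agree ij)) (*-identityˡ (c i)))) (c>0 i))
        p : Fin T'
        p = proj₁ found
        pX : ∀ x → sampleX' p x ≡ fX x
        pX (inj₁ x) rewrite proj₁ (proj₂ found) = iX x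
        pX (inj₂ (x , h)) rewrite proj₂ (proj₂ found) = trans (jX x) (cong fX (copyX-old h))
        pY : ∀ y → sampleY' p y ≡ fY y
        pY (inj₁ y) rewrite proj₁ (proj₂ found) = iY y
        pY (inj₂ (y , h)) rewrite proj₂ (proj₂ found) = trans (jY y) (cong fY (copyY-old h))

      module _ (k : ℕ) (W : Vec (Fin m) k → Vec (Fin n) k → Bool) where
        private
          A₀ : Vec (Fin T) k → Bool
          A₀ = proj₁ (event k W)

        -- The first sample maps the original edges and the second the copied ones, so both have to
        -- satisfy the old event.
        A' : Vec (Fin T') k → Bool
        A' v = A₀ (Vec.map fst v) ∧ A₀ (Vec.map snd v)

        A'-sound : ∀ v → A' v ≡ true → ∀ x y → R' x y →
          W (Vec.map (λ p → sampleX' p x) v) (Vec.map (λ p → sampleY' p y) v) ≡ true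
        A'-sound v h _ _ (orig {x} {y} r) =
          trans (cong₂ W (Vec.map-∘ (λ i → sampleX i x) fst v) (Vec.map-∘ (λ i → sampleY i y) fst v))
                (proj₁ (proj₂ (event k W)) (Vec.map fst v) (∧-trueˡ h) x y r)
        A'-sound v h _ _ (copy {x} {y} r _) =
          trans (cong₂ W (trans (Vec.map-cong (λ p → sampleX'-copy p x) v) (Vec.map-∘ (λ i → sampleX i x) snd v))
                         (trans (Vec.map-cong (λ p → sampleY'-copy p y) v) (Vec.map-∘ (λ i → sampleY i y) snd v)))
                (proj₁ (proj₂ (event k W)) (Vec.map snd v)
                  (∧-trueʳ {A₀ (Vec.map fst v)} h) x y r)

        A'-sum : sumVec T' k (ind ∘ A') ≡ sumVec T k (λ u → sumVec T k (λ v →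
                   (prodVec₂ e u v * prodVec c u) * (ind (A₀ u) * ind (A₀ v))))
        A'-sum = trans (sumVec-pairs k (λ u v → ind (A₀ u ∧ A₀ v)))
          (sumVec-cong k λ u → sumVec-cong k λ v → cong₂ _*_
            (trans (prodVec₂-* e (λ i _ → c i) u v) (cong (prodVec₂ e u v *_) (prodVec₂-constʳ c u v)))
            (ind-∧ (A₀ u) (A₀ v)))

        A'-bound : count k W ^ (K + K) * T' ^ k ≤ sumVec T' k (ind ∘ A') * (edgeCount ^ k) ^ (K + K)
        -- The factor `T ^ k` completes the square of `w * T ^ k` on the left; on the right it is
        -- the total mass in `resample`.
        A'-bound = *-cancelˡ-≤ (T ^ k) {{m^n≢0 T k}} (begin
          T ^ k * (count k W ^ (K + K) * T' ^ k)
            ≡⟨ cong₂ (λ x y → T ^ k * (x * y)) (^-distribˡ-+-* (count k W) K K)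
                 (trans (cong (_^ k) T'≡) (^-distribʳ-* k T L)) ⟩
          T ^ k * (w * w * (T ^ k * L ^ k))
            ≡⟨ re₁ (T ^ k) w (L ^ k) ⟩
          L ^ k * ((w * T ^ k) * (w * T ^ k))
            ≤⟨ *-monoʳ-≤ (L ^ k) (*-mono-≤ bound bound) ⟩
          L ^ k * ((s₁ * q) * (s₁ * q))
            ≡⟨ re₂ (L ^ k) s₁ q ⟩
          (L ^ k * (s₁ * s₁)) * (q * q)
            ≤⟨ *-monoˡ-≤ (q * q) (resample k (prodVec₂ e) (prodVec c) (ind ∘ A₀) (L ^ k)
                 {{m^n≢0 L k {{T !≢0}}}} eᵏ-sym eᵏ-class (cᵏ-size k)) ⟩
          (sumVec T k (λ _ → 1) * s₂) * (q * q)
            ≡⟨ cong₂ (λ x y → (x * y) * (q * q)) ones (sym A'-sum) ⟩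
          (T ^ k * sumVec T' k (ind ∘ A')) * (q * q)
            ≡⟨ trans (*-assoc (T ^ k) _ _)
                 (cong (λ x → T ^ k * (sumVec T' k (ind ∘ A') * x)) (sym (^-distribˡ-+-* (edgeCount ^ k) K K))) ⟩
          T ^ k * (sumVec T' k (ind ∘ A') * (edgeCount ^ k) ^ (K + K)) ∎)
          where
          open ≤-Reasoning
          w q s₁ s₂ : ℕ
          w = count k W ^ K
          q = (edgeCount ^ k) ^ K
          s₁ = sumVec T k (ind ∘ A₀)
          s₂ = sumVec T k (λ u → sumVec T k (λ v → (prodVec₂ e u v * prodVec c u) * (ind (A₀ u) * ind (A₀ v))))
          bound : w * T ^ k ≤ s₁ * q
          bound = proj₂ (proj₂ (event k W))
          ones : sumVec T k (λ _ → 1) ≡ T ^ k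
          ones = trans (sumVec-cong k (λ v → sym (trans (prodVec-const 1 v) (^-zeroˡ k))))
            (trans (sumVec-prodVec k (λ _ → 1)) (cong (_^ k) (sumFin-one T)))
          re₁ : ∀ t w l → t * (w * w * (t * l)) ≡ l * ((w * t) * (w * t))
          re₁ = solve-∀
          re₂ : ∀ l s q → l * ((s * q) * (s * q)) ≡ (l * (s * s)) * (q * q)
          re₂ = solve-∀

    sampler-double : Sampler R'
    sampler-double = record
      { searchX = search-⊎ searchX (search-Σ searchX)
      ; searchY = search-⊎ searchY (search-Σ searchY)
      ; T = T'
      ; K = K + K
      ; T≢0 = subst NonZero (sym T'≡) (m*n≢0 T L {{T≢0}} {{T !≢0}})
      ; K≢0 = >-nonZero (≤-trans (>-nonZero⁻¹ K) (m≤m+n K K))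
      ; sampleX = sampleX'
      ; sampleY = sampleY'
      ; full = full'
      ; event = λ k W → A' k W , A'-sound k W , A'-bound k W
      }

  sampler : ∃[ x ] ∃[ y ] Edge E x y → ∀ {X Y} {R : X → Y → Set} → Constructible X Y R → Sampler R
  sampler e single               = sampler-single e
  sampler e (double fixX fixY c) = sampler-double fixX fixY (sampler e c)
  sampler e (collapse inX inY c r) = sampler-collapse inX inY r (sampler e c)
  sampler e (rename f g h c)     = sampler-rename f g h (sampler e c)

-- Exponential parallel repetition

^-cancelˡ-≤ : ∀ K .{{_ : NonZero K}} {x y} → x ^ K ≤ y ^ K → x ≤ y
^-cancelˡ-≤ K h = ≮⇒≥ λ y<x → <⇒≱ (^-monoˡ-< K y<x) h

-- Bernoulli's inequality 1 - j/q ≤ (1 - 1/q)^j for q = `suc p`, with denominators cleared.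
-- Truncation makes the left side vanish for large j.
bernoulli : ∀ p j → suc p ^ j * (suc p ∸ j) ≤ p ^ j * suc p
bernoulli p zero    = ≤-refl
bernoulli p (suc j) = begin
  (q * q ^ j) * (p ∸ j)        ≡⟨ re₁ q (q ^ j) (p ∸ j) ⟩
  q ^ j * (q * (p ∸ j))        ≤⟨ *-monoʳ-≤ (q ^ j) shift ⟩
  q ^ j * (p * (q ∸ j))        ≡⟨ re₂ (q ^ j) p (q ∸ j) ⟩
  p * (q ^ j * (q ∸ j))        ≤⟨ *-monoʳ-≤ p (bernoulli p j) ⟩
  p * (p ^ j * q)              ≡⟨ *-assoc p (p ^ j) q ⟨
  (p * p ^ j) * q              ∎
  where
  open ≤-Reasoning
  q = suc p
  re₁ : ∀ q x y → (q * x) * y ≡ x * (q * y)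
  re₁ = solve-∀
  re₂ : ∀ x p y → x * (p * y) ≡ p * (x * y)
  re₂ = solve-∀
  shift : q * (p ∸ j) ≤ p * (q ∸ j)
  shift with j ≤? p
  ... | yes j≤p = begin
    (p ∸ j) + p * (p ∸ j)  ≤⟨ +-monoˡ-≤ _ (m∸n≤m p j) ⟩
    p + p * (p ∸ j)        ≡⟨ *-suc p (p ∸ j) ⟨
    p * suc (p ∸ j)        ≡⟨ cong (p *_) (+-∸-assoc 1 j≤p) ⟨
    p * (q ∸ j)            ∎
  ... | no j≰p = ≤-trans (≤-reflexive (trans (cong (q *_) (m≤n⇒m∸n≡0 (<⇒≤ (≰⇒> j≰p)))) (*-zeroʳ q))) z≤n

sumFin-others : ∀ {t} (i₀ : Fin t) → suc (sumFin t (λ i → ind (not (does (i Fin.≟ i₀))))) ≡ t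
sumFin-others {suc t} zero     = cong suc (sumFin-one t)
sumFin-others {suc t} (suc i₀) = cong suc (sumFin-others i₀)

module _ {m n : ℕ} {E : Fin m → Fin n → Bool} where

  allEdges-ind : ∀ (G : Game E) {k} (u : Vec (Fin m) k) (v : Vec (Fin n) k) →
    ind (Game.allEdges G u v) ≡ prodVec₂ (λ x y → ind (E x y)) u v
  allEdges-ind G []      []      = refl
  allEdges-ind G (x ∷ u) (y ∷ v) =
    trans (ind-∧ (E x y) _) (cong (ind (E x y) *_) (allEdges-ind G u v))

  numQuestions≡ : ∀ (G : Game E) k → Game.numQuestions G k ≡ edgeCount E ^ k
  numQuestions≡ G k = begin
    sumVec m k (λ u → sumVec n k (λ v → ind (Game.allEdges G u v)))
      ≡⟨ sumVec-cong k (λ u → sumVec-cong k (λ v → trans (allEdges-ind G u v) (sym (*-identityʳ _)))) ⟩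
    sumVec m k (λ u → sumVec n k (λ v → prodVec₂ (λ x y → ind (E x y)) u v * 1))
      ≡⟨ EdgePairs.sumVec-pairs E k (λ _ _ → 1) ⟨
    sumVec (edgeCount E) k (λ _ → 1)
      ≡⟨ sumVec-cong k (λ v → sym (trans (prodVec-const 1 v) (^-zeroˡ k))) ⟩
    sumVec (edgeCount E) k (prodVec (λ _ → 1))
      ≡⟨ sumVec-prodVec k (λ _ → 1) ⟩
    sumFin (edgeCount E) (λ _ → 1) ^ k
      ≡⟨ cong (_^ k) (sumFin-one (edgeCount E)) ⟩
    edgeCount E ^ k ∎
    where open ≡-Reasoning

  allAccept-lookup : ∀ (G : Game E) {k} (u : Vec (Fin m) k) (v : Vec (Fin n) k) as bs →
    Game.allAccept G u v as bs ≡ true → ∀ j →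
    Game.V G (Vec.lookup u j) (Vec.lookup v j) (Vec.lookup as j) (Vec.lookup bs j) ≡ true
  allAccept-lookup G (x ∷ u) (y ∷ v) (a ∷ as) (b ∷ bs) h zero    = ∧-trueˡ h
  allAccept-lookup G (x ∷ u) (y ∷ v) (a ∷ as) (b ∷ bs) h (suc j) =
    allAccept-lookup G u v as bs (∧-trueʳ {Game.V G x y a b} h) j

  sampler⇒repetition : Sampler E (Edge E) → ExponentialParallelRepetition E
  sampler⇒repetition s = pred q , q , ≤-reflexive (suc-pred q) , bound
    where
    open Sampler s
    q : ℕ
    q = K * T
    instance
      q≢0 : NonZero q
      q≢0 = m*n≢0 K T
    identity : ∃[ i ] (∀ x → sampleX i x ≡ x) × (∀ y → sampleY i y ≡ y)
    identity = full id id (λ _ _ e → e)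
    i₀ : Fin T
    i₀ = proj₁ identity
    other : Fin T → ℕ
    other i = ind (not (does (i Fin.≟ i₀)))
    P : ℕ
    P = sumFin T other
    P<T : suc P ≡ T
    P<T = sumFin-others i₀
    -- Here P = T - 1. The choice q = K * T turns 1 - 1/T into 1 - K/q, so that `bernoulli` with
    -- exponent K bounds it by (1 - 1/q)^K, a K-th power of a rational number.
    root : P * q ^ K ≤ pred q ^ K * T
    root = *-cancelˡ-≤ K (begin
      K * (P * q ^ K)                                  ≡⟨ re₁ K P (q ^ K) ⟩
      q ^ K * (K * P)                                  ≡⟨ cong (q ^ K *_) KP ⟩
      q ^ K * (q ∸ K)                                  ≡⟨ cong (λ z → z ^ K * (z ∸ K)) (suc-pred q) ⟨
      suc (pred q) ^ K * (suc (pred q) ∸ K)            ≤⟨ bernoulli (pred q) K ⟩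
      pred q ^ K * suc (pred q)                        ≡⟨ cong (pred q ^ K *_) (suc-pred q) ⟩
      pred q ^ K * (K * T)                             ≡⟨ re₂ (pred q ^ K) K T ⟩
      K * (pred q ^ K * T)                             ∎)
      where
      open ≤-Reasoning
      KP : K * P ≡ q ∸ K
      KP = sym (trans (cong (_∸ K) (trans (cong (K *_) (sym P<T)) (*-suc K P))) (m+n∸m≡n K (K * P)))
      re₁ : ∀ k p x → k * (p * x) ≡ x * (k * p)
      re₁ = solve-∀
      re₂ : ∀ x k t → x * (k * t) ≡ k * (x * t)
      re₂ = solve-∀

    module _ (G : Game E) (G-nontrivial : Game.NonTrivial G) (k : ℕ)
             (S₁ : Vec (Fin m) k → Vec (Fin (suc (Game.a₁ G))) k)
             (S₂ : Vec (Fin n) k → Vec (Fin (suc (Game.a₂ G))) k) where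
      W : Vec (Fin m) k → Vec (Fin n) k → Bool
      W u v = Game.allAccept G u v (S₁ u) (S₂ v)

      numWon≡ : Game.numWon G k S₁ S₂ ≡ count E k W
      numWon≡ = sumVec-cong k λ u → sumVec-cong k λ v →
        trans (ind-∧ (Game.allEdges G u v) _) (cong (_* ind (W u v)) (allEdges-ind G u v))

      won : Vec (Fin T) k → Bool
      won = proj₁ (event k W)

      -- A winning homomorphism that is the identity in coordinate j turns the
      -- j-th answers into a perfect strategy of the single game.
      avoids-identity : ∀ v → won v ≡ true → ∀ j → Vec.lookup v j ≢ i₀
      avoids-identity v h j v-j = G-nontrivial
        (λ x → Vec.lookup (S₁ (questionsX x)) j)
        (λ y → Vec.lookup (S₂ (questionsY y)) j)
        (λ x y e → subst₂
          (λ x' y' → Game.V G x' y' (Vec.lookup (S₁ (questionsX x)) j) (Vec.lookup (S₂ (questionsY y)) j) ≡ true)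
          (trans (Vec.lookup-map j (λ i → sampleX i x) v)
            (trans (cong (λ i → sampleX i x) v-j) (proj₁ (proj₂ identity) x)))
          (trans (Vec.lookup-map j (λ i → sampleY i y) v)
            (trans (cong (λ i → sampleY i y) v-j) (proj₂ (proj₂ identity) y)))
          (allAccept-lookup G (questionsX x) (questionsY y) _ _ (proj₁ (proj₂ (event k W)) v h x y e) j))
        where
        questionsX : Fin m → Vec (Fin m) k
        questionsX x = Vec.map (λ i → sampleX i x) v
        questionsY : Fin n → Vec (Fin n) k
        questionsY y = Vec.map (λ i → sampleY i y) v

      others-prod : ∀ {k} (v : Vec (Fin T) k) → (∀ j → Vec.lookup v j ≢ i₀) → prodVec other v ≡ 1
      others-prod []      _ = refl
      others-prod (i ∷ v) h =
        cong₂ _*_ (cong (ind ∘ not) (dec-false (i Fin.≟ i₀) (h zero))) (others-prod v (h ∘ suc))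

      won≤ : ∀ v → ind (won v) ≤ prodVec other v
      won≤ v with won v in eq
      ... | false = z≤n
      ... | true  = ≤-reflexive (sym (others-prod v (avoids-identity v eq)))

      won-count : sumVec T k (ind ∘ won) ≤ P ^ k
      won-count = ≤-trans (sumVec-mono k won≤) (≤-reflexive (sumVec-prodVec k other))

      bound : Game.numWon G k S₁ S₂ * q ^ k ≤ pred q ^ k * Game.numQuestions G k
      -- The sampler bounds the K-th power of the number of wins, so the two sides are compared
      -- after raising them to the power K.
      bound rewrite numWon≡ | numQuestions≡ G k = ^-cancelˡ-≤ K (*-cancelˡ-≤ (T ^ k) {{m^n≢0 T k}} (begin
        T ^ k * (w * q ^ k) ^ K
          ≡⟨ trans (cong (T ^ k *_) (trans (^-distribʳ-* K w (q ^ k)) (cong (w ^ K *_) (swap-^ q k K))))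
               (re₁ (T ^ k) (w ^ K) ((q ^ K) ^ k)) ⟩
        (w ^ K * T ^ k) * (q ^ K) ^ k
          ≤⟨ *-monoˡ-≤ _ (≤-trans (proj₂ (proj₂ (event k W))) (*-monoˡ-≤ (Q ^ K) won-count)) ⟩
        (P ^ k * Q ^ K) * (q ^ K) ^ k
          ≡⟨ re₂ (P ^ k) (Q ^ K) ((q ^ K) ^ k) ⟩
        (P ^ k * (q ^ K) ^ k) * Q ^ K
          ≡⟨ cong (_* Q ^ K) (^-distribʳ-* k P (q ^ K)) ⟨
        (P * q ^ K) ^ k * Q ^ K
          ≤⟨ *-monoˡ-≤ (Q ^ K) (^-monoˡ-≤ k root) ⟩
        (pred q ^ K * T) ^ k * Q ^ K
          ≡⟨ cong (_* Q ^ K) (trans (^-distribʳ-* k (pred q ^ K) T) (cong (_* T ^ k) (swap-^ (pred q) K k))) ⟩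
        ((pred q ^ k) ^ K * T ^ k) * Q ^ K
          ≡⟨ trans (re₃ ((pred q ^ k) ^ K) (T ^ k) (Q ^ K)) (cong (T ^ k *_) (sym (^-distribʳ-* K (pred q ^ k) Q))) ⟩
        T ^ k * (pred q ^ k * Q) ^ K ∎))
        where
        open ≤-Reasoning
        w Q : ℕ
        w = count E k W
        Q = edgeCount E ^ k
        swap-^ : ∀ x i j → (x ^ i) ^ j ≡ (x ^ j) ^ i
        swap-^ x i j = trans (^-*-assoc x i j) (trans (cong (x ^_) (*-comm i j)) (sym (^-*-assoc x j i)))
        re₁ : ∀ t w x → t * (w * x) ≡ (w * t) * x
        re₁ = solve-∀
        re₂ : ∀ p q x → (p * q) * x ≡ (p * x) * q
        re₂ = solve-∀
        re₃ : ∀ p t x → (p * t) * x ≡ t * (p * x)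
        re₃ = solve-∀

-- Walks and path-lifting extensions

module _ {X Y : Set} where

  side : X ⊎ Y → Bool
  side (inj₁ _) = true
  side (inj₂ _) = false

  Adj : (X → Y → Set) → X ⊎ Y → X ⊎ Y → Set
  Adj R (inj₁ x) (inj₂ y) = R x y
  Adj R (inj₂ y) (inj₁ x) = R x y
  Adj R (inj₁ _) (inj₁ _) = ⊥
  Adj R (inj₂ _) (inj₂ _) = ⊥

  Walk : (X → Y → Set) → ℕ → X ⊎ Y → X ⊎ Y → Set
  Walk R zero    u v = u ≡ v
  Walk R (suc n) u v = ∃[ w ] Adj R u w × Walk R n w v

  module _ {R : X → Y → Set} where

    Adj-sym : ∀ u v → Adj R u v → Adj R v u
    Adj-sym (inj₁ _) (inj₂ _) r = r
    Adj-sym (inj₂ _) (inj₁ _) r = r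

    Adj-side : ∀ u v → Adj R u v → side v ≡ not (side u)
    Adj-side (inj₁ _) (inj₂ _) r = refl
    Adj-side (inj₂ _) (inj₁ _) r = refl

    Walk-snoc : ∀ n {u v w} → Walk R n u v → Adj R v w → Walk R (suc n) u w
    Walk-snoc zero    {w = w} refl        e = w , e , refl
    Walk-snoc (suc n) (z , e′ , p) e = z , e′ , Walk-snoc n p e

    Walk-reverse : ∀ n {u v} → Walk R n u v → Walk R n v u
    Walk-reverse zero    refl        = refl
    Walk-reverse (suc n) {u} (z , e , p) = Walk-snoc n (Walk-reverse n p) (Adj-sym u z e)

-- Replaces arithmetic modulo 2: in a bipartite graph the colours of the ends of a walk determine
-- the parity of its length.
flips : ℕ → Bool → Bool
flips zero    b = b
flips (suc n) b = flips n (not b)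

flips-not : ∀ n b → flips n (not b) ≢ flips n b
flips-not zero    true  ()
flips-not zero    false ()
flips-not (suc n) b = flips-not n (not b)

Walk-side : ∀ {X Y : Set} {R : X → Y → Set} n {u v} → Walk R n u v → side v ≡ flips n (side u)
Walk-side zero    refl = refl
Walk-side (suc n) {u} (w , e , p) = trans (Walk-side n p) (cong (flips n) (Adj-side u w e))

Walk-map : ∀ {X Y X' Y' : Set} {R : X → Y → Set} {R' : X' → Y' → Set} (f : X ⊎ Y → X' ⊎ Y') →
  (∀ u v → Adj R u v → Adj R' (f u) (f v)) → ∀ n {u v} → Walk R n u v → Walk R' n (f u) (f v)
Walk-map f f-adj zero    refl        = refl
Walk-map f f-adj (suc n) (w , e , p) = f w , f-adj _ w e , Walk-map f f-adj n p

module OverGraph {m n : ℕ} (E : Fin m → Fin n → Bool)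
  (neighbourX : ∀ x → ∃[ y ] Edge E x y) (neighbourY : ∀ y → ∃[ x ] Edge E x y) where

  V : Set
  V = Fin m ⊎ Fin n

  _~_ : V → V → Set
  _~_ = Adj (Edge E)

  Path : ℕ → V → V → Set
  Path = Walk (Edge E)

  _≟_ : DecidableEquality V
  _≟_ = Sum.≡-dec Fin._≟_ Fin._≟_

  neighbour : ∀ u → ∃[ w ] u ~ w
  neighbour (inj₁ x) = inj₂ (proj₁ (neighbourX x)) , proj₂ (neighbourX x)
  neighbour (inj₂ y) = inj₁ (proj₁ (neighbourY y)) , proj₂ (neighbourY y)

  adj? : ∀ u v → Dec (u ~ v)
  adj? (inj₁ x) (inj₂ y) = E x y Bool.≟ true
  adj? (inj₂ y) (inj₁ x) = E x y Bool.≟ true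
  adj? (inj₁ _) (inj₁ _) = no λ ()
  adj? (inj₂ _) (inj₂ _) = no λ ()

  any? : {P : V → Set} → (∀ v → Dec (P v)) → Dec (∃ P)
  any? P? = map′ (λ { (inj₁ (x , p)) → inj₁ x , p ; (inj₂ (y , p)) → inj₂ y , p })
                 (λ { (inj₁ x , p) → inj₁ (x , p) ; (inj₂ y , p) → inj₂ (y , p) })
                 (Fin.any? (P? ∘ inj₁) ⊎-dec Fin.any? (P? ∘ inj₂))

  path? : ∀ k u v → Dec (Path k u v)
  path? zero    u v = u ≟ v
  path? (suc k) u v = any? (λ w → adj? u w ×-dec path? k w v)

  Nearest : ℕ → V → V → Set
  Nearest d u v = Path d u v × (∀ k → Path k u v → d ≤ k)

  -- G may be disconnected, so the search stops at N; in the second alternative there is no path of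
  -- length at most N to lift.
  nearest? : ∀ N u v → (∃[ d ] d ≤ N × Nearest d u v) ⊎ (∀ k → k ≤ N → ¬ Path k u v)
  nearest? zero u v with path? 0 u v
  ... | yes p = inj₁ (0 , z≤n , p , λ _ _ → z≤n)
  ... | no ¬p = inj₂ λ { zero z≤n → ¬p }
  nearest? (suc N) u v with nearest? N u v
  ... | inj₁ (d , d≤N , near) = inj₁ (d , m≤n⇒m≤1+n d≤N , near)
  ... | inj₂ none with path? (suc N) u v
  ...   | yes p = inj₁ (suc N , ≤-refl , p , λ k q → ≰⇒> (λ k≤N → none k k≤N q))
  ...   | no ¬p = inj₂ λ k k≤ q → none k (≤-pred (≤∧≢⇒< k≤ λ { refl → ¬p q })) q

  -- Homomorphisms to G: folding onto an edge, wrapping onto a path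

  record Hom {X Y : Set} (R : X → Y → Set) : Set where
    field
      map      : X ⊎ Y → V
      map-side : ∀ u → side (map u) ≡ side u
      map-adj  : ∀ u v → Adj R u v → map u ~ map v

  open Hom

  -- The 2-colouring is itself a homomorphism onto an edge. This yields a projection for a second
  -- copy when at most one vertex has a prescribed image.
  onto-edge : ∀ {X Y : Set} {R : X → Y → Set} (u v : V) → u ~ v → Hom R
  onto-edge {X} {Y} {R} u v e = record
    { map = f
    ; map-side = f-side
    ; map-adj = f-adj
    }
    where
    f : X ⊎ Y → V
    f z = if does (side z Bool.≟ side u) then u else v
    f-side : ∀ z → side (f z) ≡ side z
    f-side z with side z Bool.≟ side u
    ... | yes p = sym p
    ... | no ¬p = trans (Adj-side u v e) (sym (Bool.¬-not ¬p))
    f-adj : ∀ z z′ → Adj R z z′ → f z ~ f z′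
    f-adj z z′ r with side z Bool.≟ side u | side z′ Bool.≟ side u
    ... | yes _ | no _  = e
    ... | no _  | yes _ = Adj-sym u v e
    ... | yes p | yes q = contradiction (trans (sym (Adj-side z z′ r)) (trans q (sym p))) (flips-not 0 _)
    ... | no ¬p | no ¬q = contradiction (trans (sym (Adj-side z z′ r)) (trans (Bool.¬-not ¬q) (sym (Bool.¬-not ¬p)))) (flips-not 0 _)

  onto-edge-same : ∀ {X Y : Set} {R : X → Y → Set} {u v} (e : u ~ v) z → side z ≡ side u →
    map (onto-edge {R = R} u v e) z ≡ u
  onto-edge-same {u = u} e z p with side z Bool.≟ side u
  ... | yes _ = refl
  ... | no ¬p = contradiction p ¬p

  onto-edge-other : ∀ {X Y : Set} {R : X → Y → Set} {u v} (e : u ~ v) z → side z ≡ not (side u) →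
    map (onto-edge {R = R} u v e) z ≡ v
  onto-edge-other {u = u} e z p with side z Bool.≟ side u
  ... | yes q = contradiction (trans (sym p) q) (flips-not 0 _)
  ... | no ¬p = refl

  -- The vertices at distance i, i+1, … from a are wrapped onto the successive vertices of a
  -- path, and the vertices further away than its length onto an edge at its end.
  wrap : ∀ (a : V) i k {p q} → Path k p q → V → V
  wrap a i zero    {p} _           z = map (onto-edge {R = Edge E} p (proj₁ (neighbour p)) (proj₂ (neighbour p))) z
  wrap a i (suc k) {p} (_ , _ , g) z = if does (path? i a z) then p else wrap a (suc i) k g z

  wrap-start : ∀ a i k {p q} (g : Path k p q) {z} → side p ≡ flips i (side a) → Path i a z → wrap a i k g z ≡ p
  wrap-start a i zero    {p} g {z} s h = onto-edge-same {R = Edge E} (proj₂ (neighbour p)) z (trans (Walk-side i h) (sym s))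
  wrap-start a i (suc k) g {z} s h rewrite dec-true (path? i a z) h = refl

  wrap-later : ∀ a i k {p w q} (e : p ~ w) (g : Path k w q) {z} → ¬ Path i a z →
    wrap a i (suc k) {p} (w , e , g) z ≡ wrap a (suc i) k g z
  wrap-later a i k e g {z} h rewrite dec-false (path? i a z) h = refl

  -- A vertex that no shorter walk from a reaches fails every test and arrives at the end of the
  -- path. For a shortest path this makes the wrapping fix the far endpoint.
  wrap-end : ∀ a i k {p q} (g : Path k p q) → (∀ j → j < i + k → ¬ Path j a q) → wrap a i k g q ≡ q
  wrap-end a i zero {p} refl h = onto-edge-same {R = Edge E} (proj₂ (neighbour p)) p refl
  wrap-end a i (suc k) {p} (w , e , g) h =
    trans (wrap-later a i k {p} e g (h i (≤-trans (≤-reflexive (+-comm 1 i)) (+-monoʳ-≤ i (s≤s z≤n)))))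
          (wrap-end a (suc i) k g (λ j j< → h j (≤-trans j< (≤-reflexive (sym (+-suc i k))))))

  flips-suc : ∀ i b → flips (suc i) b ≡ not (flips i b)
  flips-suc zero    b = refl
  flips-suc (suc i) b = flips-suc i (not b)

  next-side : ∀ (a : V) i p w → side p ≡ flips i (side a) → p ~ w → side w ≡ flips (suc i) (side a)
  next-side a i p w s e = trans (Adj-side p w e) (trans (cong not s) (sym (flips-suc i (side a))))

  wrap-side : ∀ a i k {p q} (g : Path k p q) → side p ≡ flips i (side a) → ∀ z → side (wrap a i k g z) ≡ side z
  wrap-side a i zero    {p} g s z = map-side (onto-edge {R = Edge E} p _ (proj₂ (neighbour p))) z
  wrap-side a i (suc k) {p} (w , e , g) s z with path? i a z
  ... | yes h = trans s (sym (Walk-side i h))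
  ... | no _  = wrap-side a (suc i) k g (next-side a i p w s e) z

  -- By parity the two endpoints of an edge cannot pass the same test. If one passes, the other is
  -- one step further from a and passes the next test, so the edge goes to the corresponding edge of
  -- the path.
  wrap-adj : ∀ a i k {p q} (g : Path k p q) → side p ≡ flips i (side a) →
    ∀ z z′ → z ~ z′ → wrap a i k g z ~ wrap a i k g z′
  wrap-adj a i zero    {p} g s = map-adj (onto-edge {R = Edge E} p _ (proj₂ (neighbour p)))
  wrap-adj a i (suc k) {p} (w , e , g) s z z′ r with path? i a z | path? i a z′
  ... | yes h | yes h′ = contradiction (trans (sym (Adj-side z z′ r)) (trans (Walk-side i h′) (sym (Walk-side i h)))) (flips-not 0 _)
  ... | yes h | no _   = subst (p ~_) (sym (wrap-start a (suc i) k g (next-side a i p w s e) (Walk-snoc i h r))) e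
  ... | no _  | yes h′ = Adj-sym p _ (subst (p ~_) (sym (wrap-start a (suc i) k g (next-side a i p w s e) (Walk-snoc i h′ (Adj-sym z z′ r)))) e)
  ... | no _  | no _   = wrap-adj a (suc i) k g (next-side a i p w s e) z z′ r

  -- Constructible graphs over G

  record Over : Set₁ where
    field
      X Y           : Set
      R             : X → Y → Set
      constructible : Constructible X Y R
      _≟X_          : DecidableEquality X
      _≟Y_          : DecidableEquality Y
    Vertex : Set
    Vertex = X ⊎ Y
    field
      π         : Hom R
      incident  : ∀ u → ∃[ w ] Adj R u w
      on-side   : ∀ b → Σ Vertex λ u → side u ≡ b
    _≟V_ : DecidableEquality Vertex
    _≟V_ = Sum.≡-dec _≟X_ _≟Y_
    proj : Vertex → V
    proj = map π

  record _⊑_ (H H' : Over) : Set where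
    private
      module H = Over H
      module H' = Over H'
    field
      ι      : H.Vertex → H'.Vertex
      ι-adj  : ∀ u v → Adj H.R u v → Adj H'.R (ι u) (ι v)
      ι-proj : ∀ u → H'.proj (ι u) ≡ H.proj u

  open _⊑_

  ⊑-refl : ∀ {H} → H ⊑ H
  ⊑-refl = record { ι = id ; ι-adj = λ _ _ e → e ; ι-proj = λ _ → refl }

  ⊑-trans : ∀ {H H' H''} → H ⊑ H' → H' ⊑ H'' → H ⊑ H''
  ⊑-trans f g = record
    { ι = ι g ∘ ι f
    ; ι-adj = λ u v e → ι-adj g _ _ (ι-adj f u v e)
    ; ι-proj = λ u → trans (ι-proj g (ι f u)) (ι-proj f u)
    }

  -- Only length and ends are prescribed: the walk in H need not project to the given path.
  Lifts : ℕ → (H : Over) → Over.Vertex H → Over.Vertex H → Set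
  Lifts N H u v = ∀ k → k ≤ N → Path k (Over.proj H u) (Over.proj H v) → Walk (Over.R H) k u v

  Lifts-mono : ∀ {M N} H {u v} → M ≤ N → Lifts N H u v → Lifts M H u v
  Lifts-mono H M≤N l k k≤M = l k (≤-trans k≤M M≤N)

  Lifts-sym : ∀ {N} H {u v} → Lifts N H u v → Lifts N H v u
  Lifts-sym H l k k≤N p = Walk-reverse k (l k k≤N (Walk-reverse k p))

  Lifts-ι : ∀ {N} {H H'} (f : H ⊑ H') {u v} → Lifts N H u v → Lifts N H' (ι f u) (ι f v)
  Lifts-ι f {u} {v} l k k≤N p =
    Walk-map (ι f) (ι-adj f) k (l k k≤N (subst₂ (Path k) (ι-proj f u) (ι-proj f v) p))

  module _ (H : Over) where
    open Over H

    -- Go back and forth along an edge at the start, two steps at a time; the colours rule out an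
    -- odd k.
    prolong : ∀ k d {u v} → Walk R d u v → flips (k + d) (side u) ≡ flips d (side u) → Walk R (k + d) u v
    prolong zero          d p s = p
    prolong (suc zero)    d p s = contradiction s (flips-not d _)
    prolong (suc (suc k)) d {u} p s =
      let w , e = incident u in
      w , e , u , Adj-sym u w e ,
      prolong k d p (trans (cong (flips (k + d)) (sym (Bool.not-involutive (side u)))) s)

    -- All paths with the same ends have lengths of the same parity, so a single walk of minimal
    -- length can be padded to each of them.
    shortest-lifts : ∀ {N} d {u v} → Walk R d u v → (∀ k → k ≤ N → Path k (proj u) (proj v) → d ≤ k) → Lifts N H u v
    shortest-lifts d {u} {v} p near k k≤N g =
      subst (λ z → Walk R z u v) (m∸n+n≡m d≤k) (prolong (k ∸ d) d p
        (trans (cong (λ z → flips z (side u)) (m∸n+n≡m d≤k)) (trans (sym v-k) (Walk-side d p))))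
      where
      d≤k : d ≤ k
      d≤k = near k k≤N g
      v-k : side v ≡ flips k (side u)
      v-k = trans (sym (map-side π v)) (trans (Walk-side k g) (cong (flips k) (map-side π u)))

    Lifts-refl : ∀ {N} u → Lifts N H u u
    Lifts-refl u = shortest-lifts 0 refl (λ _ _ _ → z≤n)

  -- Originals are projected by π and copies by ψ; agreement on the fixed vertices glues the two
  -- into one homomorphism. A vertex over c arises by choosing ψ so that it sends some vertex to c.
  module _ (H : Over) (fix : Over.Vertex H → Bool) (ψ : Hom (Over.R H))
           (agree : ∀ u → fix u ≡ true → map ψ u ≡ Over.proj H u) where
    open Over H
    private
      module D = Doubling R (fix ∘ inj₁) (fix ∘ inj₂)
    open DoublingProperties R (fix ∘ inj₁) (fix ∘ inj₂)

    private
      Vertex' : Set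
      Vertex' = D.X' ⊎ D.Y'

      ι' : Vertex → Vertex'
      ι' = Sum.map inj₁ inj₁

      cp : Vertex → Vertex'
      cp = Sum.map D.copyX D.copyY

      proj' : Vertex' → V
      proj' (inj₁ (inj₁ x))       = proj (inj₁ x)
      proj' (inj₁ (inj₂ (x , _))) = map ψ (inj₁ x)
      proj' (inj₂ (inj₁ y))       = proj (inj₂ y)
      proj' (inj₂ (inj₂ (y , _))) = map ψ (inj₂ y)

      proj'-ι : ∀ u → proj' (ι' u) ≡ proj u
      proj'-ι (inj₁ x) = refl
      proj'-ι (inj₂ y) = refl

      proj'-cp : ∀ u → proj' (cp u) ≡ map ψ u
      proj'-cp (inj₁ x) with D.copyX x | copyX-view x
      ... | _ | fixed h = sym (agree (inj₁ x) h)
      ... | _ | old _   = refl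
      proj'-cp (inj₂ y) with D.copyY y | copyY-view y
      ... | _ | fixed h = sym (agree (inj₂ y) h)
      ... | _ | old _   = refl

      proj'-side : ∀ u → side (proj' u) ≡ side u
      proj'-side (inj₁ (inj₁ x))       = map-side π (inj₁ x)
      proj'-side (inj₁ (inj₂ (x , _))) = map-side ψ (inj₁ x)
      proj'-side (inj₂ (inj₁ y))       = map-side π (inj₂ y)
      proj'-side (inj₂ (inj₂ (y , _))) = map-side ψ (inj₂ y)

      proj'-edge : ∀ {x y} → D.R' x y → proj' (inj₁ x) ~ proj' (inj₂ y)
      proj'-edge (Doubling.orig {x} {y} r)   = map-adj π (inj₁ x) (inj₂ y) r
      proj'-edge (Doubling.copy {x} {y} r _) =
        subst₂ _~_ (sym (proj'-cp (inj₁ x))) (sym (proj'-cp (inj₂ y))) (map-adj ψ (inj₁ x) (inj₂ y) r)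

      proj'-adj : ∀ u v → Adj D.R' u v → proj' u ~ proj' v
      proj'-adj (inj₁ x) (inj₂ y) r = proj'-edge r
      proj'-adj (inj₂ y) (inj₁ x) r = Adj-sym (proj' (inj₁ x)) (proj' (inj₂ y)) (proj'-edge r)

      ι'-adj : ∀ u v → Adj R u v → Adj D.R' (ι' u) (ι' v)
      ι'-adj (inj₁ x) (inj₂ y) r = Doubling.orig r
      ι'-adj (inj₂ y) (inj₁ x) r = Doubling.orig r

      cp-adj' : ∀ u v → Adj R u v → Adj D.R' (cp u) (cp v)
      cp-adj' (inj₁ x) (inj₂ y) r = copy-edge r
      cp-adj' (inj₂ y) (inj₁ x) r = copy-edge r

      cp-fixed' : ∀ u → fix u ≡ true → cp u ≡ ι' u
      cp-fixed' (inj₁ x) h = cong inj₁ (copyX-fixed h)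
      cp-fixed' (inj₂ y) h = cong inj₂ (copyY-fixed h)

      incident' : ∀ u → ∃[ w ] Adj D.R' u w
      incident' (inj₁ (inj₁ x)) = let w , e = incident (inj₁ x) in ι' w , ι'-adj (inj₁ x) w e
      incident' (inj₂ (inj₁ y)) = let w , e = incident (inj₂ y) in ι' w , ι'-adj (inj₂ y) w e
      incident' (inj₁ (inj₂ (x , h))) = let w , e = incident (inj₁ x) in
        cp w , subst (λ z → Adj D.R' (inj₁ z) (cp w)) (copyX-old h) (cp-adj' (inj₁ x) w e)
      incident' (inj₂ (inj₂ (y , h))) = let w , e = incident (inj₂ y) in
        cp w , subst (λ z → Adj D.R' (inj₂ z) (cp w)) (copyY-old h) (cp-adj' (inj₂ y) w e)

      old-dec : {Z : Set} {f : Z → Bool} → DecidableEquality Z → DecidableEquality (Z ⊎ Σ Z (λ z → f z ≡ false))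
      old-dec _≟Z_ = Sum.≡-dec _≟Z_ (Product.≡-dec _≟Z_ (λ p q → yes (bool-irrelevant p q)))

      ι'-side : ∀ u → side (ι' u) ≡ side u
      ι'-side (inj₁ x) = refl
      ι'-side (inj₂ y) = refl

    doubled : Over
    doubled = record
      { X = D.X'
      ; Y = D.Y'
      ; R = D.R'
      ; constructible = double (fix ∘ inj₁) (fix ∘ inj₂) constructible
      ; _≟X_ = old-dec _≟X_
      ; _≟Y_ = old-dec _≟Y_
      ; π = record { map = proj' ; map-side = proj'-side ; map-adj = proj'-adj }
      ; incident = incident'
      ; on-side = λ b → let u , s = on-side b in ι' u , trans (ι'-side u) s
      }

    first : H ⊑ doubled
    first = record { ι = ι' ; ι-adj = ι'-adj ; ι-proj = proj'-ι }

    second : Vertex → Over.Vertex doubled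
    second = cp

    second-adj : ∀ u v → Adj R u v → Adj (Over.R doubled) (second u) (second v)
    second-adj = cp-adj'

    second-fixed : ∀ u → fix u ≡ true → second u ≡ ι first u
    second-fixed = cp-fixed'

    second-proj : ∀ u → Over.proj doubled (second u) ≡ map ψ u
    second-proj = proj'-cp

  -- Adding a vertex to a graph over G

  record Extended (H : Over) (c : V) : Set₁ where
    field
      H'   : Over
      emb  : H ⊑ H'
      new  : Over.Vertex H'
      lies : Over.proj H' new ≡ c

  open Extended

  -- With nothing fixed the second copy is disjoint from the first and may be folded onto any edge
  -- at c. `on-side` supplies a vertex of the right colour.
  add-isolated : (H : Over) (c : V) → Extended H c
  add-isolated H c = record
    { H' = doubled H fix ψ agree
    ; emb = first H fix ψ agree
    ; new = second H fix ψ agree u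
    ; lies = trans (second-proj H fix ψ agree u) (onto-edge-same {R = Over.R H} (proj₂ (neighbour c)) u u-side)
    }
    where
    u : Over.Vertex H
    u = proj₁ (Over.on-side H (side c))
    u-side : side u ≡ side c
    u-side = proj₂ (Over.on-side H (side c))
    fix : Over.Vertex H → Bool
    fix _ = false
    ψ : Hom (Over.R H)
    ψ = onto-edge c (proj₁ (neighbour c)) (proj₂ (neighbour c))
    agree : ∀ v → fix v ≡ true → map ψ v ≡ Over.proj H v
    agree v ()

  NextTo : (H : Over) (a : Over.Vertex H) {c : V} → Extended H c → Set
  NextTo H a x = Adj (Over.R (H' x)) (ι (emb x) a) (new x)

  -- Any neighbour z of `a` can be copied: since `a` is fixed, the copy is adjacent to it, and the
  -- colouring sends z to c.
  add-pendant : (H : Over) (a : Over.Vertex H) (c : V) → Over.proj H a ~ c →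
    Σ (Extended H c) (NextTo H a)
  add-pendant H a c e = record
    { H' = doubled H fix ψ agree
    ; emb = first H fix ψ agree
    ; new = second H fix ψ agree z
    ; lies = trans (second-proj H fix ψ agree z) (onto-edge-other {R = R} e z
               (trans (Adj-side a z a-z) (cong not (sym (map-side π a)))))
    } , subst (λ u → Adj (Over.R (doubled H fix ψ agree)) u (second H fix ψ agree z))
          (second-fixed H fix ψ agree a (dec-true (a ≟V a) refl))
          (second-adj H fix ψ agree a z a-z)
    where
    open Over H
    z : Vertex
    z = proj₁ (incident a)
    a-z : Adj R a z
    a-z = proj₂ (incident a)
    fix : Vertex → Bool
    fix u = does (u ≟V a)
    ψ : Hom R
    ψ = onto-edge (proj a) c e
    agree : ∀ u → fix u ≡ true → map ψ u ≡ proj u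
    agree u h with u ≟V a
    ... | yes refl = onto-edge-same {R = R} e a (sym (map-side π a))

  -- Lift a shortest path through c; its first step z may project to another neighbour of `proj a`.
  -- The wrapping θ corrects this, as it sends all these neighbours to c, and it fixes the
  -- projections of `a` and `b`, so the copy of z has the required walk to `b`.
  add-on-shortest : (H : Over) (a b : Over.Vertex H) (c : V) (N d : ℕ) → Lifts N H a b → suc d ≤ N →
    (∀ k → Path k (Over.proj H a) (Over.proj H b) → suc d ≤ k) →
    Over.proj H a ~ c → Path d c (Over.proj H b) →
    Σ (Extended H c) λ x → NextTo H a x × Walk (Over.R (H' x)) d (new x) (ι (emb x) b)
  add-on-shortest H a b c N d l d<N near e g = record
    { H' = doubled H fix ψ agree
    ; emb = first H fix ψ agree
    ; new = second H fix ψ agree z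
    ; lies = trans (second-proj H fix ψ agree z) ψ-z
    } , subst (λ u → Adj (Over.R (doubled H fix ψ agree)) u (second H fix ψ agree z))
          (second-fixed H fix ψ agree a (cong (_∨ does (a ≟V b)) (dec-true (a ≟V a) refl)))
          (second-adj H fix ψ agree a z a-z)
      , subst (Walk (Over.R (doubled H fix ψ agree)) d (second H fix ψ agree z))
          (second-fixed H fix ψ agree b (trans (cong (does (b ≟V a) ∨_) (dec-true (b ≟V b) refl)) (Bool.∨-zeroʳ _)))
          (Walk-map (second H fix ψ agree) (second-adj H fix ψ agree) d z-b)
    where
    open Over H
    lifted : Walk R (suc d) a b
    lifted = l (suc d) d<N (c , e , g)
    z : Vertex
    z = proj₁ lifted
    a-z : Adj R a z
    a-z = proj₁ (proj₂ lifted)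
    z-b : Walk R d z b
    z-b = proj₂ (proj₂ lifted)
    fix : Vertex → Bool
    fix u = does (u ≟V a) ∨ does (u ≟V b)
    θ : V → V
    θ = wrap (proj a) 0 (suc d) (c , e , g)
    ψ : Hom R
    ψ = record
      { map = θ ∘ proj
      ; map-side = λ u → trans (wrap-side (proj a) 0 (suc d) (c , e , g) refl (proj u)) (map-side π u)
      ; map-adj = λ u v r → wrap-adj (proj a) 0 (suc d) (c , e , g) refl (proj u) (proj v) (map-adj π u v r)
      }
    agree : ∀ u → fix u ≡ true → map ψ u ≡ proj u
    agree u h with u ≟V a | u ≟V b
    ... | yes refl | _        = wrap-start (proj a) 0 (suc d) (c , e , g) refl refl
    ... | no _     | yes refl = wrap-end (proj a) 0 (suc d) (c , e , g) (λ j j<d p → <⇒≱ j<d (near j p))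
    ψ-z : map ψ z ≡ c
    ψ-z = trans
      (wrap-later (proj a) 0 d {proj a} e g λ p → ~-irrefl (subst (proj a ~_) (sym p) (map-adj π a z a-z)))
      (wrap-start (proj a) 1 d g (Adj-side (proj a) c e) (proj z , map-adj π a z a-z , refl))
      where
      ~-irrefl : ¬ (proj a ~ proj a)
      ~-irrefl r = flips-not 0 _ (sym (Adj-side (proj a) (proj a) r))

  LiftsTo : ℕ → (H : Over) (b : Over.Vertex H) {c : V} → Extended H c → Set
  LiftsTo N H b x = Lifts N (H' x) (new x) (ι (emb x) b)

  add-farther : (H : Over) (a b : Over.Vertex H) (c : V) (N d : ℕ) → Lifts (suc N) H a b → d ≤ suc N →
    Nearest d (Over.proj H a) (Over.proj H b) → Over.proj H a ~ c →
    (∀ k → d ≡ suc k → ¬ Path k c (Over.proj H b)) →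
    Σ (Extended H c) λ x → NextTo H a x × LiftsTo N H b x
  add-farther H a b c N d l d≤N (p , near) e farther = x , adj , shortest-lifts (H' x) (suc d)
    (ι (emb x) a , Adj-sym (ι (emb x) a) (new x) adj , Walk-map (ι (emb x)) (ι-adj (emb x)) d (l d d≤N p))
    λ k _ g → longer k (subst₂ (Path k) (lies x) (ι-proj (emb x) b) g)
    where
    open Over H
    pendant : Σ (Extended H c) (NextTo H a)
    pendant = add-pendant H a c e
    x : Extended H c
    x = proj₁ pendant
    adj : NextTo H a x
    adj = proj₂ pendant
    -- One more step at the front gives a path from `proj a`, so k is at least d - 1. The value d -
    -- 1 is excluded by `farther` and the value d by parity.
    longer : ∀ k → Path k c (proj b) → suc d ≤ k
    longer k g = ≰⇒> λ k≤d → case (m≤n⇒m<n∨m≡n k≤d)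
      where
      case : k < d ⊎ k ≡ d → ⊥
      case (inj₁ k<d)  = farther k (≤-antisym (near (suc k) (c , e , g)) k<d) g
      case (inj₂ refl) = flips-not d (side (proj a))
        (trans (sym (trans (Walk-side d g) (cong (flips d) (Adj-side (proj a) c e)))) (Walk-side d p))

  -- If c is nearer to b than a, it is added by copying a shortest path from a to b; otherwise a
  -- pendant vertex at a does, as c is then one further away from b than a.
  add-neighbour : (H : Over) (a b : Over.Vertex H) (c : V) (N : ℕ) → Lifts (suc N) H a b → Over.proj H a ~ c →
    Σ (Extended H c) λ x → NextTo H a x × LiftsTo N H b x
  add-neighbour H a b c N l e with nearest? (suc N) (Over.proj H a) (Over.proj H b)
  ... | inj₂ none = let x , adj = add-pendant H a c e in x , adj , λ k k≤N g →
          contradiction (c , e , subst₂ (Path k) (lies x) (ι-proj (emb x) b) g) (none (suc k) (s≤s k≤N))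
  ... | inj₁ (zero , d≤N , near) = add-farther H a b c N zero l d≤N near e λ _ ()
  ... | inj₁ (suc d , d≤N , p , near) with path? d c (Over.proj H b)
  ...   | no ¬g = add-farther H a b c N (suc d) l d≤N (p , near) e λ { k refl → ¬g }
  ...   | yes g = let x , adj , q = add-on-shortest H a b c (suc N) d l d≤N near e g in
          x , adj , shortest-lifts (H' x) d q λ k _ g' →
            ≤-pred (near (suc k) (c , e , subst₂ (Path k) (lies x) (ι-proj (emb x) b) g'))

  -- Each step costs one unit of the bound, because a path of length k from the new vertex is
  -- compared with one of length k + 1 from its predecessor.
  add-along : (H : Over) (a b : Over.Vertex H) (c : V) (N d : ℕ) → Lifts (d + N) H a b → Path d (Over.proj H a) c →
    Σ (Extended H c) λ x → Walk (Over.R (H' x)) d (ι (emb x) a) (new x) × LiftsTo N H b x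
  add-along H a b c N zero    l g = record { H' = H ; emb = ⊑-refl ; new = a ; lies = g } , refl , l
  add-along H a b c N (suc d) l (w , e , g) =
    let x , adj , l₁ = add-neighbour H a b w (d + N) l e
        y , p , l₂ = add-along (H' x) (new x) (ι (emb x) b) c N d l₁ (subst (λ z → Path d z c) (sym (lies x)) g)
    in record { H' = H' y ; emb = ⊑-trans (emb x) (emb y) ; new = new y ; lies = lies y } ,
       (ι (emb y) (new x) , ι-adj (emb y) (ι (emb x) a) (new x) adj , p) , l₂

  -- The way to c spends d ≤ N of the bound and leaves N towards `b`. Towards `a` the walk just
  -- built lifts a shortest path, which is enough.
  add-near : (H : Over) (a b : Over.Vertex H) (c : V) (N d : ℕ) → d ≤ N → Lifts (N + N) H a b →
    Nearest d (Over.proj H a) c → Σ (Extended H c) λ x → LiftsTo N H a x × LiftsTo N H b x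
  add-near H a b c N d d≤N l (g , near) =
    let x , p , l′ = add-along H a b c N d (Lifts-mono H (+-monoˡ-≤ N d≤N) l) g
    in x , Lifts-sym (H' x) (shortest-lifts (H' x) d p (λ k _ h →
         near k (subst₂ (Path k) (ι-proj (emb x) a) (lies x) h))) , l′

  -- The walk to c may start at whichever of the two is within distance N. If both are further away,
  -- the requirement is vacuous and an isolated vertex does.
  add-vertex : (H : Over) (a b : Over.Vertex H) (c : V) (N : ℕ) → Lifts (N + N) H a b →
    Σ (Extended H c) λ x → LiftsTo N H a x × LiftsTo N H b x
  add-vertex H a b c N l with nearest? N (Over.proj H a) c | nearest? N (Over.proj H b) c
  ... | inj₁ (d , d≤N , near) | _ = add-near H a b c N d d≤N l near
  ... | inj₂ _ | inj₁ (d , d≤N , near) =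
    let x , lb , la = add-near H b a c N d d≤N (Lifts-sym H l) near in x , la , lb
  ... | inj₂ far-a | inj₂ far-b = x , unlinked a far-a , unlinked b far-b
    where
    x : Extended H c
    x = add-isolated H c
    unlinked : ∀ u → (∀ k → k ≤ N → ¬ Path k (Over.proj H u) c) → LiftsTo N H u x
    unlinked u far k k≤N g = contradiction
      (Walk-reverse k (subst₂ (Path k) (lies x) (ι-proj (emb x) u) g)) (far k k≤N)

  add-vertex? : (H : Over) (a b : Maybe (Over.Vertex H)) (c : V) (N : ℕ) →
    (∀ u v → a ≡ just u → b ≡ just v → Lifts (N + N) H u v) →
    Σ (Extended H c) λ x → (∀ u → a ≡ just u → LiftsTo N H u x) × (∀ u → b ≡ just u → LiftsTo N H u x)
  add-vertex? H (just a) (just b) c N l =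
    let x , la , lb = add-vertex H a b c N (l a b refl refl)
    in x , (λ { _ refl → la }) , (λ { _ refl → lb })
  add-vertex? H (just a) nothing c N l =
    let x , la , _ = add-vertex H a a c N (Lifts-refl H a)
    in x , (λ { _ refl → la }) , (λ _ ())
  add-vertex? H nothing (just b) c N l =
    let x , _ , lb = add-vertex H b b c N (Lifts-refl H b)
    in x , (λ _ ()) , (λ { _ refl → lb })
  add-vertex? H nothing nothing c N l = add-isolated H c , (λ _ ()) , (λ _ ())

  -- Partial sections of the projection

  record Partial : Set₁ where
    field
      H         : Over
      lift      : V → Maybe (Over.Vertex H)
      lift-proj : ∀ {v w} → lift v ≡ just w → Over.proj H w ≡ v

  open Partial

  Known : Partial → V → Set
  Known S v = ∃[ w ] lift S v ≡ just w

  Linked : ℕ → Partial → V → V → Set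
  Linked N S u v = ∃[ w ] ∃[ w' ] lift S u ≡ just w × lift S v ≡ just w' × Lifts N (H S) w w'

  Linked-mono : ∀ {M N} S {u v} → M ≤ N → Linked N S u v → Linked M S u v
  Linked-mono S M≤N (w , w' , p , p' , l) = w , w' , p , p' , Lifts-mono (H S) M≤N l

  Linked-refl : ∀ {N} S {u} → Known S u → Linked N S u u
  Linked-refl S (w , p) = w , w , p , p , Lifts-refl (H S) w

  module _ (S : Partial) (c : V) (x : Extended (H S) c) where

    private
      lift' : V → Maybe (Over.Vertex (H' x))
      lift' v = if does (v ≟ c) then just (new x) else Maybe.map (ι (emb x)) (lift S v)

      lift'-new : lift' c ≡ just (new x)
      lift'-new rewrite dec-true (c ≟ c) refl = refl

      lift'-old : ∀ {v} → v ≢ c → lift' v ≡ Maybe.map (ι (emb x)) (lift S v)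
      lift'-old {v} v≢c rewrite dec-false (v ≟ c) v≢c = refl

      lift'-proj : ∀ {v w} → lift' v ≡ just w → Over.proj (H' x) w ≡ v
      lift'-proj {v} p with v ≟ c
      ... | yes refl with refl ← p = lies x
      ... | no _ with lift S v in eq
      ...   | just w with refl ← p = trans (ι-proj (emb x) w) (lift-proj S eq)

    insert : Partial
    insert = record { H = H' x ; lift = lift' ; lift-proj = lift'-proj }

    insert-new : lift insert c ≡ just (new x)
    insert-new = lift'-new

    insert-old : ∀ {v w} → v ≢ c → lift S v ≡ just w → lift insert v ≡ just (ι (emb x) w)
    insert-old v≢c p = trans (lift'-old v≢c) (cong (Maybe.map (ι (emb x))) p)

    insert-known : ∀ {v} → Known insert v → v ≡ c ⊎ Known S v
    insert-known {v} (w , p) with v ≟ c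
    ... | yes v≡c = inj₁ v≡c
    ... | no _ with lift S v
    ...   | just w' = inj₂ (w' , refl)

    insert-linked : ∀ {N u v} → u ≢ c → v ≢ c → Linked N S u v → Linked N insert u v
    insert-linked u≢c v≢c (w , w' , p , p' , l) =
      _ , _ , insert-old u≢c p , insert-old v≢c p' , Lifts-ι (emb x) l

  AllLinked : ℕ → Partial → (V → Set) → Set
  AllLinked N S T = ∀ u v → T u → T v → Known S u → Known S v → Linked N S u v

  -- Old pairs keep their bound for every N, since the embedding of the old graph preserves walks;
  -- only pairs with a new vertex get a smaller one.
  record Grown (S : Partial) (New : V → Set) : Set₁ where
    field
      S'        : Partial
      linked    : ∀ {N u v} → Linked N S u v → Linked N S' u v
      only-new  : ∀ {v} → Known S' v → New v ⊎ Known S v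

  open Grown

  grown-known : ∀ {S New} (g : Grown S New) {v} → Known S v → Known (S' g) v
  grown-known {S} g k with linked g (Linked-refl {0} S k)
  ... | w , _ , p , _ = w , p

  -- This is where width two enters: besides c the bag contains at most `a` and `b`, and
  -- `add-vertex` meets two constraints at once when their lifts are linked.
  add-to-bag : (S : Partial) (T : V → Set) (c a b : V) (N : ℕ) → T c → T a → T b →
    (∀ v → T v → v ≡ c ⊎ v ≡ a ⊎ v ≡ b) → AllLinked (N + N) S T →
    Σ (Grown S T) λ g → Known (S' g) c × AllLinked N (S' g) T
  add-to-bag S T c a b N Tc Ta Tb only l with lift S c in eq
  ... | just w = record { S' = S ; linked = id ; only-new = inj₂ } , (w , eq) ,
        λ u v Tu Tv ku kv → Linked-mono S (m≤m+n N N) (l u v Tu Tv ku kv)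
  ... | nothing = record { S' = S⁺ ; linked = old-linked ; only-new = new-known } ,
        (new x , insert-new S c x) , all
    where
    added : Σ (Extended (H S) c) λ x → (∀ u → lift S a ≡ just u → LiftsTo N (H S) u x)
                                     × (∀ u → lift S b ≡ just u → LiftsTo N (H S) u x)
    added = add-vertex? (H S) (lift S a) (lift S b) c N both
      where
      both : ∀ u v → lift S a ≡ just u → lift S b ≡ just v → Lifts (N + N) (H S) u v
      both u v p q with l a b Ta Tb (u , p) (v , q)
      ... | w , w' , p' , q' , lw =
        subst₂ (Lifts (N + N) (H S)) (Maybe.just-injective (trans (sym p') p)) (Maybe.just-injective (trans (sym q') q)) lw
    x : Extended (H S) c
    x = proj₁ added
    S⁺ : Partial
    S⁺ = insert S c x
    known≢c : ∀ {v w} → lift S v ≡ just w → v ≢ c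
    known≢c p refl with () ← trans (sym eq) p
    old-linked : ∀ {M u v} → Linked M S u v → Linked M S⁺ u v
    old-linked k@(_ , _ , p , p' , _) = insert-linked S c x (known≢c p) (known≢c p') k
    new-known : ∀ {v} → Known S⁺ v → T v ⊎ Known S v
    new-known k with insert-known S c x k
    ... | inj₁ refl = inj₁ Tc
    ... | inj₂ k'   = inj₂ k'
    to-c : ∀ {v} → T v → Known S v → ∃[ w ] lift S v ≡ just w × Lifts N (H' x) (new x) (ι (emb x) w)
    to-c {v} Tv (w , p) with only v Tv
    ... | inj₁ refl = contradiction refl (known≢c p)
    ... | inj₂ (inj₁ refl) = w , p , proj₁ (proj₂ added) w p
    ... | inj₂ (inj₂ refl) = w , p , proj₂ (proj₂ added) w p
    all : AllLinked N S⁺ T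
    all u v Tu Tv ku kv with insert-known S c x ku | insert-known S c x kv
    ... | inj₂ ku' | inj₂ kv' = old-linked (Linked-mono S (m≤m+n N N) (l u v Tu Tv ku' kv'))
    ... | inj₁ refl | inj₁ refl = Linked-refl S⁺ ku
    ... | inj₁ refl | inj₂ kv' = let w , p , lw = to-c Tv kv' in
          new x , _ , insert-new S c x , insert-old S c x (known≢c p) p , lw
    ... | inj₂ ku' | inj₁ refl = let w , p , lw = to-c Tu ku' in
          _ , new x , insert-old S c x (known≢c p) p , insert-new S c x , Lifts-sym (H' x) lw

  -- Adding a vertex halves the length up to which paths are known to lift; a bag has at most three.
  octuple : ℕ → ℕ
  octuple N = ((N + N) + (N + N)) + ((N + N) + (N + N))

  add-triple : (S : Partial) (T : V → Set) (a b c : V) (N : ℕ) → T a → T b → T c →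
    (∀ v → T v → v ≡ a ⊎ v ≡ b ⊎ v ≡ c) → AllLinked (octuple N) S T →
    Σ (Grown S T) λ g → (∀ v → T v → Known (S' g) v) × AllLinked N (S' g) T
  add-triple S T a b c N Ta Tb Tc only l =
    let g₁ , ka , l₁ = add-to-bag S T a b c ((N + N) + (N + N)) Ta Tb Tc only l
        g₂ , kb , l₂ = add-to-bag (S' g₁) T b a c (N + N) Tb Ta Tc (λ v Tv → swap (only v Tv)) l₁
        g₃ , kc , l₃ = add-to-bag (S' g₂) T c a b N Tc Ta Tb (λ v Tv → rotate (only v Tv)) l₂
    in record
         { S' = S' g₃
         ; linked = linked g₃ ∘ linked g₂ ∘ linked g₁
         ; only-new = λ k → Sum.[ inj₁ , (λ k₂ → Sum.[ inj₁ , only-new g₁ ] (only-new g₂ k₂)) ] (only-new g₃ k)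
         }
       , (λ v Tv → known g₁ g₂ g₃ ka kb kc (only v Tv))
       , l₃
    where
    swap : ∀ {P Q R : Set} → P ⊎ Q ⊎ R → Q ⊎ P ⊎ R
    swap (inj₁ p)        = inj₂ (inj₁ p)
    swap (inj₂ (inj₁ q)) = inj₁ q
    swap (inj₂ (inj₂ r)) = inj₂ (inj₂ r)
    rotate : ∀ {P Q R : Set} → P ⊎ Q ⊎ R → R ⊎ P ⊎ Q
    rotate (inj₁ p)        = inj₂ (inj₁ p)
    rotate (inj₂ (inj₁ q)) = inj₂ (inj₂ q)
    rotate (inj₂ (inj₂ r)) = inj₁ r
    known : ∀ (g₁ : Grown S T) (g₂ : Grown (S' g₁) T) (g₃ : Grown (S' g₂) T) →
      Known (S' g₁) a → Known (S' g₂) b → Known (S' g₃) c → ∀ {v} → v ≡ a ⊎ v ≡ b ⊎ v ≡ c → Known (S' g₃) v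
    known g₁ g₂ g₃ ka kb kc (inj₁ refl)        = grown-known g₃ (grown-known g₂ ka)
    known g₁ g₂ g₃ ka kb kc (inj₂ (inj₁ refl)) = grown-known g₃ kb
    known g₁ g₂ g₃ ka kb kc (inj₂ (inj₂ refl)) = kc

-- Tree decompositions of width two

elements : ∀ {n} → Subset n → List (Fin n)
elements []          = []
elements (true ∷ p)  = zero ∷ List.map suc (elements p)
elements (false ∷ p) = List.map suc (elements p)

length-elements : ∀ {n} (p : Subset n) → length (elements p) ≡ ∣ p ∣
length-elements []          = refl
length-elements (true ∷ p)  = cong suc (trans (List.length-map suc (elements p)) (length-elements p))
length-elements (false ∷ p) = trans (List.length-map suc (elements p)) (length-elements p)

∈-elements⁺ : ∀ {n} {p : Subset n} {x} → x ∈ₛ p → x ∈ elements p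
∈-elements⁺ {p = true ∷ p}  here      = here refl
∈-elements⁺ {p = true ∷ p}  (there h) = there (∈-map⁺ suc (∈-elements⁺ h))
∈-elements⁺ {p = false ∷ p} (there h) = ∈-map⁺ suc (∈-elements⁺ h)

∈-elements⁻ : ∀ {n} {p : Subset n} {x} → x ∈ elements p → x ∈ₛ p
∈-elements⁻ {p = true ∷ p}  (here refl) = here
∈-elements⁻ {p = true ∷ p}  (there h) with _ , h' , refl ← ∈-map⁻ suc h = there (∈-elements⁻ h')
∈-elements⁻ {p = false ∷ p} h         with _ , h' , refl ← ∈-map⁻ suc h = there (∈-elements⁻ h')

-- Subtrees and the parent of a node

module _ (T : Tree) where
  open Tree T

  data Below (i : Node) : Node → Set where
    self  : Below i i
    child : ∀ {a} → Below i (par a) → Below i (suc a)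

  Below-≤ : ∀ {i j} → Below i j → toℕ i ≤ toℕ j
  Below-≤ self          = ≤-refl
  Below-≤ (child {a} b) = ≤-trans (Below-≤ b) (<⇒≤ (par< a))

  -- A connected set leaves the subtree below a node only through its parent.
  through-parent : ∀ {S} a {j} → ConnIn S (suc a) j → Below (suc a) j ⊎ S (par a)
  through-parent a (here _) = inj₁ self
  through-parent a (step c e s) with through-parent a c
  ... | inj₂ p = inj₂ p
  through-parent a (step c (inj₂ (b , refl , refl)) s) | inj₁ below = inj₁ (child below)
  through-parent a (step c (inj₁ (b , refl , refl)) s) | inj₁ self = inj₂ s
  through-parent a (step c (inj₁ (b , refl , refl)) s) | inj₁ (child below) = inj₁ below

  -- Indices grow away from the root, so a node of smaller index lies outside the subtree below
  -- `suc a`, and the connection must pass through the parent.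
  earlier⇒parent : ∀ {S} a {j} → toℕ j < toℕ (suc a) → ConnIn S (suc a) j → S (par a)
  earlier⇒parent a j<a c with through-parent a c
  ... | inj₁ below = contradiction (Below-≤ below) (<⇒≱ j<a)
  ... | inj₂ p     = p

-- Lifting the bags one after the other

module _ {m n : ℕ} (E : Fin m → Fin n → Bool) (edge : ∃[ x ] ∃[ y ] Edge E x y)
  (neighbourX : ∀ x → ∃[ y ] Edge E x y) (neighbourY : ∀ y → ∃[ x ] Edge E x y)
  (D : TreeDecomposition E) (width : ∀ i → TreeDecomposition.bucketSize D i ≤ 3) where

  open OverGraph E neighbourX neighbourY
  open TreeDecomposition D using (tree; bucketX; bucketY; nonemptyX; nonemptyY; connectedX; connectedY; covers)
  open Tree tree using (t; par; par<; Node; ConnIn)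
  open Partial
  open Grown
  open Hom
  open Over using (proj)

  Bag : Node → V → Set
  Bag i (inj₁ x) = x ∈ₛ bucketX i
  Bag i (inj₂ y) = y ∈ₛ bucketY i

  bag : Node → List V
  bag i = List.map inj₁ (elements (bucketX i)) ++ List.map inj₂ (elements (bucketY i))

  length-bag : ∀ i → length (bag i) ≤ 3
  length-bag i = ≤-trans (≤-reflexive (trans (List.length-++ (List.map inj₁ (elements (bucketX i))))
    (cong₂ _+_ (trans (List.length-map inj₁ (elements (bucketX i))) (length-elements (bucketX i)))
               (trans (List.length-map inj₂ (elements (bucketY i))) (length-elements (bucketY i)))))) (width i)

  ∈-bag⁺ : ∀ i v → Bag i v → v ∈ bag i
  ∈-bag⁺ i (inj₁ x) h = ∈-++⁺ˡ (∈-map⁺ inj₁ (∈-elements⁺ h))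
  ∈-bag⁺ i (inj₂ y) h = ∈-++⁺ʳ (List.map inj₁ (elements (bucketX i))) (∈-map⁺ inj₂ (∈-elements⁺ h))

  ∈-bag⁻ : ∀ i v → v ∈ bag i → Bag i v
  ∈-bag⁻ i v h with ∈-++⁻ (List.map inj₁ (elements (bucketX i))) h
  ... | inj₁ hx with _ , hx' , refl ← ∈-map⁻ inj₁ hx = ∈-elements⁻ hx'
  ... | inj₂ hy with _ , hy' , refl ← ∈-map⁻ inj₂ hy = ∈-elements⁻ hy'

  connected : ∀ v i j → Bag i v → Bag j v → ConnIn (λ k → Bag k v) i j
  connected (inj₁ x) = connectedX x
  connected (inj₂ y) = connectedY y

  in-some-bag : ∀ v → ∃[ i ] Bag i v
  in-some-bag (inj₁ x) = nonemptyX x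
  in-some-bag (inj₂ y) = nonemptyY y

  -- Smaller bags repeat a vertex; a repeated insertion finds it lifted already.
  add-bag : (S : Partial) (T : V → Set) (L : List V) (N : ℕ) → length L ≤ 3 →
    (∀ v → v ∈ L → T v) → (∀ v → T v → v ∈ L) → AllLinked (octuple N) S T →
    Σ (Grown S T) λ g → (∀ v → T v → Known (S' g) v) × AllLinked N (S' g) T
  add-bag S T [] N _ sound complete l = record { S' = S ; linked = id ; only-new = inj₂ } ,
    (λ v Tv → empty (complete v Tv)) , (λ u v Tu → empty (complete u Tu))
    where
    empty : ∀ {v} {P : Set} → v ∈ [] → P
    empty ()
  add-bag S T (a ∷ []) N _ sound complete l = add-triple S T a a a N Ta Ta Ta
    (λ v Tv → cases (complete v Tv)) l
    where
    Ta = sound a (here refl)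
    cases : ∀ {v} → v ∈ a ∷ [] → v ≡ a ⊎ v ≡ a ⊎ v ≡ a
    cases (here p) = inj₁ p
  add-bag S T (a ∷ b ∷ []) N _ sound complete l = add-triple S T a b b N Ta Tb Tb
    (λ v Tv → cases (complete v Tv)) l
    where
    Ta = sound a (here refl)
    Tb = sound b (there (here refl))
    cases : ∀ {v} → v ∈ a ∷ b ∷ [] → v ≡ a ⊎ v ≡ b ⊎ v ≡ b
    cases (here p)         = inj₁ p
    cases (there (here p)) = inj₂ (inj₁ p)
  add-bag S T (a ∷ b ∷ c ∷ []) N _ sound complete l = add-triple S T a b c N
    (sound a (here refl)) (sound b (there (here refl))) (sound c (there (there (here refl))))
    (λ v Tv → cases (complete v Tv)) l
    where
    cases : ∀ {v} → v ∈ a ∷ b ∷ c ∷ [] → v ≡ a ⊎ v ≡ b ⊎ v ≡ c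
    cases (here p)                 = inj₁ p
    cases (there (here p))         = inj₂ (inj₁ p)
    cases (there (there (here p))) = inj₂ (inj₂ p)
  add-bag S T (_ ∷ _ ∷ _ ∷ _ ∷ _) N (s≤s (s≤s (s≤s ()))) sound complete l

  -- The field `known` keeps lifted vertices inside processed bags. Connectedness of the buckets
  -- then places those that meet the next bag in its parent.
  record Processed (k N : ℕ) : Set₁ where
    field
      S       : Partial
      bagged  : ∀ j → toℕ j < k → ∀ u v → Bag j u → Bag j v → Linked N S u v
      known   : ∀ v → Known S v → ∃[ j ] toℕ j < k × Bag j v

  open Processed

  process-none : ∀ N → Processed 0 N
  process-none N = record
    { S = record
      { H = record
        { X = ⊤
        ; Y = ⊤
        ; R = λ _ _ → ⊤
        ; constructible = single
        ; _≟X_ = λ _ _ → yes refl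
        ; _≟Y_ = λ _ _ → yes refl
        ; π = record { map = base ; map-side = base-side ; map-adj = base-adj }
        ; incident = λ { (inj₁ _) → inj₂ tt , tt ; (inj₂ _) → inj₁ tt , tt }
        ; on-side = λ { true → inj₁ tt , refl ; false → inj₂ tt , refl }
        }
      ; lift = λ _ → nothing
      ; lift-proj = λ ()
      }
    ; bagged = λ _ ()
    ; known = λ _ ()
    }
    where
    -- The initial edge only provides something to double; neither of its vertices counts as a lift.
    base : ⊤ ⊎ ⊤ → V
    base (inj₁ _) = inj₁ (proj₁ edge)
    base (inj₂ _) = inj₂ (proj₁ (proj₂ edge))
    base-side : ∀ u → side (base u) ≡ side u
    base-side (inj₁ _) = refl
    base-side (inj₂ _) = refl
    base-adj : ∀ u v → Adj (λ _ _ → ⊤) u v → base u ~ base v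
    base-adj (inj₁ _) (inj₂ _) _ = proj₂ (proj₂ edge)
    base-adj (inj₂ _) (inj₁ _) _ = proj₂ (proj₂ edge)

  in-parent : ∀ a v → Bag (suc a) v → ∃[ j ] toℕ j < suc (toℕ a) × Bag j v → Bag (par a) v
  in-parent a v h (j , j<a , h') = earlier⇒parent tree a j<a (connected v (suc a) j h h')

  -- The vertices of the bag lifted so far all lie in the parent bag, which was processed earlier
  -- and has its pairs linked. At the root nothing is lifted yet.
  bag-linked : ∀ i {N} (P : Processed (toℕ i) N) → AllLinked N (S P) (Bag i)
  bag-linked zero    P u v hu hv ku kv with known P u ku
  ... | _ , () , _
  bag-linked (suc a) P u v hu hv ku kv =
    bagged P (par a) (par< a) u v (in-parent a u hu (known P u ku)) (in-parent a v hv (known P v kv))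

  process-bag : ∀ i {N} → Processed (toℕ i) (octuple N) → Processed (suc (toℕ i)) N
  process-bag i {N} P = record
    { S = S' g
    ; bagged = new-bagged
    ; known = new-known
    }
    where
    result : Σ (Grown (S P) (Bag i)) λ g → (∀ v → Bag i v → Known (S' g) v) × AllLinked N (S' g) (Bag i)
    result = add-bag (S P) (Bag i) (bag i) N (length-bag i) (∈-bag⁻ i) (∈-bag⁺ i) (bag-linked i P)
    g : Grown (S P) (Bag i)
    g = proj₁ result
    N≤ : N ≤ octuple N
    N≤ = ≤-trans (≤-trans (m≤m+n N N) (m≤m+n (N + N) (N + N))) (m≤m+n _ _)
    new-bagged : ∀ j → toℕ j < suc (toℕ i) → ∀ u v → Bag j u → Bag j v → Linked N (S' g) u v
    new-bagged j j<i u v hu hv with m≤n⇒m<n∨m≡n (≤-pred j<i)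
    ... | inj₁ j<i' = Linked-mono (S' g) N≤ (linked g (bagged P j j<i' u v hu hv))
    ... | inj₂ j≡i rewrite Fin.toℕ-injective j≡i =
      proj₂ (proj₂ result) u v hu hv (proj₁ (proj₂ result) u hu) (proj₁ (proj₂ result) v hv)
    new-known : ∀ v → Known (S' g) v → ∃[ j ] toℕ j < suc (toℕ i) × Bag j v
    new-known v k with only-new g k
    ... | inj₁ h = i , ≤-refl , h
    ... | inj₂ k' = let j , j<i , h = known P v k' in j , m≤n⇒m≤1+n j<i , h

  -- Equal to 8^r for r bags still to come: each bag costs a factor of eight, and length 1 must be
  -- left at the end to lift edges.
  budget : ℕ → ℕ
  budget zero    = 1
  budget (suc r) = octuple (budget r)

  process-first : ∀ k r → k + r ≡ suc t → Processed k (budget r)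
  process-first zero    r eq = process-none (budget r)
  process-first (suc k) r eq =
    subst (λ z → Processed (suc z) (budget r)) (Fin.toℕ-fromℕ< k<t)
      (process-bag (fromℕ< k<t) (subst (λ z → Processed z (budget (suc r))) (sym (Fin.toℕ-fromℕ< k<t))
        (process-first k (suc r) (trans (+-suc k r) eq))))
    where
    k<t : k < suc t
    k<t = ≤-trans (m≤m+n (suc k) r) (≤-reflexive eq)

  process-all : Processed (suc t) 1
  process-all = process-first (suc t) 0 (+-identityʳ (suc t))

  -- The lifting is a section of the projection, so the given graph is a retract of H.
  retract : (S : Partial) → (∀ v → Known S v) → (∀ u v → u ~ v → Linked 1 S u v) →
    Constructible (Fin m) (Fin n) (Edge E)
  retract S all-known edge-linked = rename
    (mk↔ₛ′ (λ a → pX (proj₁ a)) (λ x → sX x , mem-X x) p-s-X (λ a → Σ-≡ (from-mem-X (proj₁ a) (proj₂ a))))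
    (mk↔ₛ′ (λ b → pY (proj₁ b)) (λ y → sY y , mem-Y y) p-s-Y (λ b → Σ-≡ (from-mem-Y (proj₁ b) (proj₂ b))))
    (λ a b → mk⇔ (p-hom (proj₁ a) (proj₁ b))
      (λ e → subst₂ (H.R) (from-mem-X (proj₁ a) (proj₂ a)) (from-mem-Y (proj₁ b) (proj₂ b)) (s-hom _ _ e)))
    (collapse inX inY H.constructible record
      { hX = λ x → sX (pX x) , mem-X (pX x)
      ; hY = λ y → sY (pY y) , mem-Y (pY y)
      ; hom = λ x y r → s-hom _ _ (p-hom x y r)
      ; idX = λ a → Σ-≡ (from-mem-X (proj₁ a) (proj₂ a))
      ; idY = λ b → Σ-≡ (from-mem-Y (proj₁ b) (proj₂ b))
      })
    where
    module H = Over (H S)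
    at-X : (u : H.Vertex) → side u ≡ true → Σ H.X λ x → u ≡ inj₁ x
    at-X (inj₁ x) _ = x , refl
    at-Y : (u : H.Vertex) → side u ≡ false → Σ H.Y λ y → u ≡ inj₂ y
    at-Y (inj₂ y) _ = y , refl
    lift-side : ∀ {v w} → lift S v ≡ just w → side w ≡ side v
    lift-side {v} {w} p = trans (sym (map-side H.π w)) (cong side (lift-proj S p))
    X-lift : ∀ x → Σ H.X λ z → lift S (inj₁ x) ≡ just (inj₁ z)
    X-lift x = let w , p = all-known (inj₁ x) ; z , q = at-X w (lift-side p) in z , trans p (cong just q)
    Y-lift : ∀ y → Σ H.Y λ z → lift S (inj₂ y) ≡ just (inj₂ z)
    Y-lift y = let w , p = all-known (inj₂ y) ; z , q = at-Y w (lift-side p) in z , trans p (cong just q)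
    sX : Fin m → H.X
    sX x = proj₁ (X-lift x)
    sY : Fin n → H.Y
    sY y = proj₁ (Y-lift y)
    G-at-X : (u : V) → side u ≡ true → Σ (Fin m) λ x → u ≡ inj₁ x
    G-at-X (inj₁ x) _ = x , refl
    G-at-Y : (u : V) → side u ≡ false → Σ (Fin n) λ y → u ≡ inj₂ y
    G-at-Y (inj₂ y) _ = y , refl
    X-proj : ∀ z → Σ (Fin m) λ x → proj (H S) (inj₁ z) ≡ inj₁ x
    X-proj z = G-at-X _ (map-side H.π (inj₁ z))
    Y-proj : ∀ z → Σ (Fin n) λ y → proj (H S) (inj₂ z) ≡ inj₂ y
    Y-proj z = G-at-Y _ (map-side H.π (inj₂ z))
    pX : H.X → Fin m
    pX z = proj₁ (X-proj z)
    pY : H.Y → Fin n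
    pY z = proj₁ (Y-proj z)
    p-s-X : ∀ x → pX (sX x) ≡ x
    p-s-X x = Sum.inj₁-injective (trans (sym (proj₂ (X-proj (sX x)))) (lift-proj S (proj₂ (X-lift x))))
    p-s-Y : ∀ y → pY (sY y) ≡ y
    p-s-Y y = Sum.inj₂-injective (trans (sym (proj₂ (Y-proj (sY y)))) (lift-proj S (proj₂ (Y-lift y))))
    p-hom : ∀ x y → H.R x y → Edge E (pX x) (pY y)
    p-hom x y r = subst₂ _~_ (proj₂ (X-proj x)) (proj₂ (Y-proj y)) (map-adj H.π (inj₁ x) (inj₂ y) r)
    s-hom : ∀ x y → Edge E x y → H.R (sX x) (sY y)
    s-hom x y e with edge-linked (inj₁ x) (inj₂ y) e
    ... | w , w' , p , p' , l
      with refl ← Maybe.just-injective (trans (sym p) (proj₂ (X-lift x)))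
         | refl ← Maybe.just-injective (trans (sym p') (proj₂ (Y-lift y)))
      with l 1 ≤-refl (subst₂ (Path 1) (sym (lift-proj S p)) (sym (lift-proj S p')) (inj₂ y , e , refl))
    ... | _ , r , refl = r
    -- The image of the section is described as the set of fixed points of projecting and lifting
    -- again, which makes membership decidable.
    inX : H.X → Bool
    inX z = does (sX (pX z) H.≟X z)
    inY : H.Y → Bool
    inY z = does (sY (pY z) H.≟Y z)
    mem-X : ∀ x → inX (sX x) ≡ true
    mem-X x = dec-true (sX (pX (sX x)) H.≟X sX x) (cong sX (p-s-X x))
    mem-Y : ∀ y → inY (sY y) ≡ true
    mem-Y y = dec-true (sY (pY (sY y)) H.≟Y sY y) (cong sY (p-s-Y y))
    from-mem-X : ∀ z → inX z ≡ true → sX (pX z) ≡ z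
    from-mem-X z h with sX (pX z) H.≟X z
    ... | yes p = p
    from-mem-Y : ∀ z → inY z ≡ true → sY (pY z) ≡ z
    from-mem-Y z h with sY (pY z) H.≟Y z
    ... | yes p = p
    Σ-≡ : ∀ {Z : Set} {f : Z → Bool} {z z' : Z} {h : f z ≡ true} {h' : f z' ≡ true} →
      z ≡ z' → _≡_ {A = Σ Z (λ z → f z ≡ true)} (z , h) (z' , h')
    Σ-≡ refl = cong (_ ,_) (bool-irrelevant _ _)

  treewidth2⇒constructible : Constructible (Fin m) (Fin n) (Edge E)
  treewidth2⇒constructible = retract (S process-all) all-known edge-linked
    where
    linked-bag : ∀ i u v → Bag i u → Bag i v → Linked 1 (S process-all) u v
    linked-bag i = bagged process-all i (Fin.toℕ<n i)
    all-known : ∀ v → Known (S process-all) v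
    all-known v = let i , h = in-some-bag v ; w , _ , p , _ = linked-bag i v v h h in w , p
    edge-linked : ∀ u v → u ~ v → Linked 1 (S process-all) u v
    edge-linked (inj₁ x) (inj₂ y) e = let i , hx , hy = covers x y e in linked-bag i (inj₁ x) (inj₂ y) hx hy
    edge-linked (inj₂ y) (inj₁ x) e = let i , hx , hy = covers x y e in linked-bag i (inj₂ y) (inj₁ x) hy hx

theorem1p11 : ∀ (m n : ℕ) (E : Fin m → Fin n → Bool) →
    TreewidthAtMost 2 E →
    ∃[ x ] ∃[ y ] Edge E x y →
    (∀ x → ∃[ y ] Edge E x y) →
    (∀ y → ∃[ x ] Edge E x y) →
    Constructible (Fin m) (Fin n) (Edge E) × ExponentialParallelRepetition E
theorem1p11 m n E (D , width) edge neighbourX neighbourY =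
  constructible , sampler⇒repetition (sampler E edge constructible)
  where
  constructible : Constructible (Fin m) (Fin n) (Edge E)
  constructible = treewidth2⇒constructible E edge neighbourX neighbourY D width
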